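{- Let $\mu$ be a real number with $1\le\mu<\theta^{ -1}$, and let $(n_k)_{k\in\mathbb{N}}$ be a sequence of positive integers such that $n_k=p_k^{j_k}$ for all $k$, where $p_k$ is a prime and $j_k\in\mathbb{N}$. If $n_k\to\infty$ as $k\to\infty$, then $T_{n_k}(\mu)\to\infty$ as $k\to\infty$.
   Context: $\mathbb{N}$ is the set of positive integers. $\tau(n)$ denotes the number of positive divisors of the positive integer $n$. For real $\mu>0$ and a positive integer $n$, $$T_n(\mu)=\frac{\max_{1\le m\le n^{1/\mu}}\tau(n+m)}{\tau(n)},$$ where the maximum is over integers $m$ in the indicated range. Here $p_k$ denotes an arbitrary prime depending on $k$ (not the $k$-th prime). The constant $\theta$ is defined by $$\theta=\inf\Big\{\lambda>0 \;:\; \sum_{k=1}^N\tau(k)=N\ln N+(2\gamma-1)N+O(N^{\lambda+\epsilon})\ \text{ for all }\epsilon>0\Big\},$$ where $\gamma$ is Euler's constant and the $O$-estimate is as $N\to\infty$ (implied constant may depend on $\epsilon$). -}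

module Defs where

open import Data.Empty using (⊥-elim)
open import Data.Integer.Base as ℤ using (+_)
import Data.Integer.Properties as ℤP
import Data.Integer.Solver as ℤS
open import Data.List.Base using (List; []; _∷_; length; map; filter; applyUpTo)
open import Data.List.Membership.Propositional using (_∈_)
open import Data.List.Membership.Propositional.Properties using (∈-filter⁺; ∈-applyUpTo⁺)
open import Data.Nat.Base as ℕ using (ℕ; zero; suc; z≤n; s≤s)
open import Data.Nat.Divisibility using (_∣?_; 1∣_)
open import Data.Nat.ListAction using (sum)
import Data.Nat.Properties as ℕP
open import Data.Product.Base using (∃-syntax; _×_; _,_; proj₁; proj₂)
open import Data.Rational
open import Data.Rational.Properties
open import Data.Rational.Solver using (module +-*-Solver)
import Data.Rational.Unnormalised.Base as ℚᵘ
open ℚᵘ using (mkℚᵘ; *≡*; *≤*)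
import Data.Rational.Unnormalised.Properties as ℚᵘP
open import Data.Sum.Base using (_⊎_; inj₁; inj₂)
open import Relation.Binary.PropositionalEquality using (_≡_; refl; sym; trans; cong; cong₂; subst; subst₂)
open import Relation.Nullary using (¬_; Dec; yes; no)
open import Relation.Nullary.Decidable using (¬¬-excluded-middle)
open +-*-Solver using (solve; _:+_; _:*_; _:-_; :-_; con; _:=_)

module RationalLemmas where

  fromᵘ-≤ : ∀ p q → p ℚᵘ.≤ q → fromℚᵘ p ≤ fromℚᵘ q
  fromᵘ-≤ p q p≤q = toℚᵘ-cancel-≤
    (ℚᵘP.≤-respʳ-≃ (ℚᵘP.≃-sym (toℚᵘ-fromℚᵘ q)) (ℚᵘP.≤-respˡ-≃ (ℚᵘP.≃-sym (toℚᵘ-fromℚᵘ p)) p≤q))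

  fromᵘ-* : ∀ p q → fromℚᵘ p * fromℚᵘ q ≡ fromℚᵘ (p ℚᵘ.* q)
  fromᵘ-* p q = toℚᵘ-injective (ℚᵘP.≃-trans (toℚᵘ-homo-* (fromℚᵘ p) (fromℚᵘ q))
    (ℚᵘP.≃-trans (ℚᵘP.*-cong (toℚᵘ-fromℚᵘ p) (toℚᵘ-fromℚᵘ q)) (ℚᵘP.≃-sym (toℚᵘ-fromℚᵘ (p ℚᵘ.* q)))))

  fromᵘ-+ : ∀ p q → fromℚᵘ p + fromℚᵘ q ≡ fromℚᵘ (p ℚᵘ.+ q)
  fromᵘ-+ p q = toℚᵘ-injective (ℚᵘP.≃-trans (toℚᵘ-homo-+ (fromℚᵘ p) (fromℚᵘ q))
    (ℚᵘP.≃-trans (ℚᵘP.+-cong (toℚᵘ-fromℚᵘ p) (toℚᵘ-fromℚᵘ q)) (ℚᵘP.≃-sym (toℚᵘ-fromℚᵘ (p ℚᵘ.+ q)))))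

  r : ℕ → ℚ
  r n = + n / 1

  recip : ℕ → ℚ
  recip n = + 1 / suc n

  r-suc : ∀ k → r (suc k) ≡ r k + 1ℚ
  r-suc k = sym (trans (fromᵘ-+ (mkℚᵘ (+ k) 0) (mkℚᵘ (+ 1) 0))
    (fromℚᵘ-cong {mkℚᵘ (+ k) 0 ℚᵘ.+ mkℚᵘ (+ 1) 0} {mkℚᵘ (+ suc k) 0} (*≡* (eq (+ k)))))
    where
    open ℤS.+-*-Solver using () renaming (solve to solveℤ; _:+_ to _⊕_; _:*_ to _⊛_; con to κ; _:=_ to _≔_)
    eq : ∀ x → (x ℤ.* + 1 ℤ.+ + 1 ℤ.* + 1) ℤ.* + 1 ≡ (+ 1 ℤ.+ x) ℤ.* + 1
    eq = solveℤ 1 (λ x → (x ⊛ κ (+ 1) ⊕ κ (+ 1) ⊛ κ (+ 1)) ⊛ κ (+ 1) ≔ (κ (+ 1) ⊕ x) ⊛ κ (+ 1)) refl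

  recip-anti : ∀ {m n} → m ℕ.≤ n → recip n ≤ recip m
  recip-anti {m} {n} m≤n = fromᵘ-≤ (mkℚᵘ (+ 1) n) (mkℚᵘ (+ 1) m)
    (*≤* (ℤ.+≤+ (ℕP.+-monoˡ-≤ 0 (s≤s m≤n))))

  0<recip : ∀ n → 0ℚ < recip n
  0<recip n = positive⁻¹ (recip n) {{normalize-pos 1 (suc n)}}

  -- j · 1/(j(a+1)) = 1/(a+1), with j = suc j′
  recip-scale : ∀ j′ a → r (suc j′) * recip (a ℕ.+ j′ ℕ.* suc a) ≡ recip a
  recip-scale j′ a = trans (fromᵘ-* (mkℚᵘ (+ suc j′) 0) (mkℚᵘ (+ 1) (a ℕ.+ j′ ℕ.* suc a)))
    (fromℚᵘ-cong {mkℚᵘ (+ suc j′) 0 ℚᵘ.* mkℚᵘ (+ 1) (a ℕ.+ j′ ℕ.* suc a)} {mkℚᵘ (+ 1) a} (*≡* (cong +_ eq)))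
    where
    eq : suc j′ ℕ.* 1 ℕ.* suc a ≡ 1 ℕ.* (1 ℕ.* (suc j′ ℕ.* suc a))
    eq = trans (cong (ℕ._* suc a) (ℕP.*-identityʳ (suc j′)))
      (sym (trans (ℕP.*-identityˡ _) (ℕP.*-identityˡ _)))

  ½recip≤ : ∀ i → ½ * recip i ≤ recip (suc i)
  ½recip≤ i = subst (_≤ recip (suc i)) (sym (fromᵘ-* (mkℚᵘ (+ 1) 1) (mkℚᵘ (+ 1) i)))
    (fromᵘ-≤ (mkℚᵘ (+ 1) 1 ℚᵘ.* mkℚᵘ (+ 1) i) (mkℚᵘ (+ 1) (suc i)) (*≤* (ℤ.+≤+ le)))
    where
    le : 1 ℕ.* suc (suc i) ℕ.≤ 1 ℕ.* (2 ℕ.* suc i)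
    le = ℕP.*-monoʳ-≤ 1 (s≤s (ℕP.≤-trans (s≤s (ℕP.m≤m+n i 0)) (ℕP.m≤n+m (suc (i ℕ.+ 0)) i)))

  archimedean : ∀ ε → 0ℚ < ε → ∃[ N ] ∀ n → N ℕ.≤ n → recip n ≤ ε
  archimedean (mkℚ (+ zero) _ _) (*<* (ℤ.+<+ ()))
  archimedean ε@(mkℚ (+ suc a) d _) _ = d , λ n d≤n →
    toℚᵘ-cancel-≤ (ℚᵘP.≤-respˡ-≃ (ℚᵘP.≃-sym (toℚᵘ-fromℚᵘ (mkℚᵘ (+ 1) n)))
      (*≤* (ℤ.+≤+ (ℕP.*-mono-≤ (s≤s (z≤n {a})) (s≤s d≤n)))))
  archimedean (mkℚ (ℤ.-[1+ _ ]) _ _) (*<* ())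

  ∣∣≤ : ∀ {p q} → - q ≤ p → p ≤ q → ∣ p ∣ ≤ q
  ∣∣≤ {p} {q} -q≤p p≤q with ∣p∣≡p∨∣p∣≡-p p
  ... | inj₁ eq = subst (_≤ q) (sym eq) p≤q
  ... | inj₂ eq = subst₂ _≤_ (sym eq) (neg-neg q) (neg-antimono-≤ -q≤p)
    where
    neg-neg : ∀ q → - (- q) ≡ q
    neg-neg = solve 1 (λ q → :- (:- q) := q) refl

  p≤∣p∣ : ∀ p → p ≤ ∣ p ∣
  p≤∣p∣ p with ∣p∣≡p∨∣p∣≡-p p
  ... | inj₁ eq = ≤-reflexive (sym eq)
  ... | inj₂ eq with ≤-total p 0ℚ
  ...   | inj₁ p≤0 = ≤-trans p≤0 (0≤∣p∣ p)
  ...   | inj₂ 0≤p = ≤-reflexive (sym (0≤p⇒∣p∣≡p 0≤p))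

  -∣p∣≤p : ∀ p → - ∣ p ∣ ≤ p
  -∣p∣≤p p = subst₂ _≤_ (cong -_ (∣-p∣≡∣p∣ p)) (neg-neg p) (neg-antimono-≤ (p≤∣p∣ (- p)))
    where
    neg-neg : ∀ q → - (- q) ≡ q
    neg-neg = solve 1 (λ q → :- (:- q) := q) refl

  triangle : ∀ a b c → ∣ a - c ∣ ≤ ∣ a - b ∣ + ∣ b - c ∣
  triangle a b c = subst (λ t → ∣ t ∣ ≤ ∣ a - b ∣ + ∣ b - c ∣) (sym (eq a b c)) (∣p+q∣≤∣p∣+∣q∣ (a - b) (b - c))
    where
    eq : ∀ a b c → a - c ≡ (a - b) + (b - c)
    eq = solve 3 (λ a b c → a :- c := (a :- b) :+ (b :- c)) refl

  dist-sym : ∀ a b → ∣ a - b ∣ ≡ ∣ b - a ∣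
  dist-sym a b = trans (sym (∣-p∣≡∣p∣ (a - b))) (cong ∣_∣ (eq a b))
    where
    eq : ∀ a b → - (a - b) ≡ b - a
    eq = solve 2 (λ a b → :- (a :- b) := b :- a) refl

  dist-refl : ∀ a → ∣ a - a ∣ ≡ 0ℚ
  dist-refl a = cong ∣_∣ (+-inverseʳ a)

  ∣∣-lipschitz : ∀ a b → ∣ ∣ a ∣ - ∣ b ∣ ∣ ≤ ∣ a - b ∣
  ∣∣-lipschitz a b = ∣∣≤ lower upper
    where
    eq : ∀ a b → a ≡ (a - b) + b
    eq = solve 2 (λ a b → a := (a :- b) :+ b) refl
    tri : ∀ a b → ∣ a ∣ ≤ ∣ a - b ∣ + ∣ b ∣
    tri a b = subst (λ t → ∣ t ∣ ≤ ∣ a - b ∣ + ∣ b ∣) (sym (eq a b)) (∣p+q∣≤∣p∣+∣q∣ (a - b) b)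
    cancel : ∀ d b → (d + b) - b ≡ d
    cancel = solve 2 (λ d b → (d :+ b) :- b := d) refl
    cancel′ : ∀ a d → a - (d + a) ≡ - d
    cancel′ = solve 2 (λ a d → a :- (d :+ a) := :- d) refl
    upper : ∣ a ∣ - ∣ b ∣ ≤ ∣ a - b ∣
    upper = subst (∣ a ∣ - ∣ b ∣ ≤_) (cancel ∣ a - b ∣ ∣ b ∣) (+-monoˡ-≤ (- ∣ b ∣) (tri a b))
    lower : - ∣ a - b ∣ ≤ ∣ a ∣ - ∣ b ∣
    lower = subst (_≤ ∣ a ∣ - ∣ b ∣) (trans (cong (λ t → ∣ a ∣ - (t + ∣ a ∣)) (dist-sym b a)) (cancel′ ∣ a ∣ ∣ a - b ∣))
      (+-monoʳ-≤ ∣ a ∣ (neg-antimono-≤ (tri b a)))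

  *-mono-≤ : ∀ {a b c d} → 0ℚ ≤ c → 0ℚ ≤ b → a ≤ b → c ≤ d → a * c ≤ b * d
  *-mono-≤ {a} {b} {c} {d} 0≤c 0≤b a≤b c≤d = ≤-trans
    (*-monoʳ-≤-nonNeg c {{nonNegative 0≤c}} a≤b) (*-monoˡ-≤-nonNeg b {{nonNegative 0≤b}} c≤d)

  0≤* : ∀ {a b} → 0ℚ ≤ a → 0ℚ ≤ b → 0ℚ ≤ a * b
  0≤* {a} {b} 0≤a 0≤b = subst (_≤ a * b) (*-zeroʳ a) (*-monoˡ-≤-nonNeg a {{nonNegative 0≤a}} 0≤b)

  0<* : ∀ {a b} → 0ℚ < a → 0ℚ < b → 0ℚ < a * b
  0<* {a} {b} 0<a 0<b = positive⁻¹ (a * b) {{pos*pos⇒pos a {{positive 0<a}} b {{positive 0<b}}}}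

  0<1/ : ∀ a (0<a : 0ℚ < a) → 0ℚ < (1/ a) {{>-nonZero 0<a}}
  0<1/ a 0<a = positive⁻¹ _ {{1/pos⇒pos a {{positive 0<a}}}}

  half : ∀ ε → ½ * ε + ½ * ε ≡ ε
  half = solve 1 (λ ε → con ½ :* ε :+ con ½ :* ε := ε) refl

  0<½ : 0ℚ < ½
  0<½ = positive⁻¹ ½

open RationalLemmas

IsCauchy : (ℕ → ℚ) → Set
IsCauchy x = ∀ ε → 0ℚ < ε → ∃[ N ] ∀ m n → N ℕ.≤ m → N ℕ.≤ n → ∣ x m - x n ∣ ≤ ε

-- Two such sequences with difference tending to 0 are different elements of this type
-- denoting the same real; _<ᴿ_ and _≤ᴿ_ below do not distinguish them.
record ℝ : Set where
  constructor mkℝ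
  field
    seq      : ℕ → ℚ
    isCauchy : IsCauchy seq

open ℝ

infix 4 _<ᴿ_ _≤ᴿ_

-- Both relations refer to limits: terms may violate x ≤ y by amounts tending to 0, and
-- x < y requires a gap that is uniform from some index on.
_<ᴿ_ : ℝ → ℝ → Set
x <ᴿ y = ∃[ δ ] 0ℚ < δ × (∃[ N ] ∀ n → N ℕ.≤ n → seq x n + δ ≤ seq y n)

_≤ᴿ_ : ℝ → ℝ → Set
x ≤ᴿ y = ∀ ε → 0ℚ < ε → ∃[ N ] ∀ n → N ℕ.≤ n → seq x n ≤ seq y n + ε

module CauchyLemmas where

  scaled : ∀ x C → 0ℚ < C →
    (∀ ε → 0ℚ < ε → ∃[ N ] ∀ m n → N ℕ.≤ m → N ℕ.≤ n → ∣ x m - x n ∣ ≤ C * ε) → IsCauchy x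
  scaled x C 0<C h ε 0<ε with h (1/C * ε) (0<* (0<1/ C 0<C) 0<ε)
    where
    1/C = (1/ C) {{>-nonZero 0<C}}
  ... | N , b = N , λ m n N≤m N≤n → subst (∣ x m - x n ∣ ≤_)
    (trans (sym (*-assoc C _ ε)) (trans (cong (_* ε) (*-inverseʳ C {{>-nonZero 0<C}})) (*-identityˡ ε)))
    (b m n N≤m N≤n)

  ordered : ∀ x → (∀ ε → 0ℚ < ε → ∃[ N ] ∀ m n → N ℕ.≤ m → m ℕ.≤ n → ∣ x m - x n ∣ ≤ ε) → IsCauchy x
  ordered x h ε 0<ε with h ε 0<ε
  ... | N , b = N , λ m n N≤m N≤n → go m n N≤m N≤n (ℕP.≤-total m n)
    where
    go : ∀ m n → N ℕ.≤ m → N ℕ.≤ n → m ℕ.≤ n ⊎ n ℕ.≤ m → ∣ x m - x n ∣ ≤ ε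
    go m n N≤m N≤n (inj₁ m≤n) = b m n N≤m m≤n
    go m n N≤m N≤n (inj₂ n≤m) = subst (_≤ ε) (dist-sym (x n) (x m)) (b n m N≤n n≤m)

  const-cauchy : ∀ q → IsCauchy (λ _ → q)
  const-cauchy q ε 0<ε = 0 , λ _ _ _ _ → subst (_≤ ε) (sym (dist-refl q)) (<⇒≤ 0<ε)

  +-cauchy : ∀ x y → IsCauchy x → IsCauchy y → IsCauchy (λ n → x n + y n)
  +-cauchy x y cx cy ε 0<ε with cx (½ * ε) (0<* 0<½ 0<ε) | cy (½ * ε) (0<* 0<½ 0<ε)
  ... | M , bx | N , by = M ℕ.⊔ N , λ m n p q →
    subst₂ _≤_ (cong ∣_∣ (eq (x m) (y m) (x n) (y n))) (half ε)
      (≤-trans (∣p+q∣≤∣p∣+∣q∣ (x m - x n) (y m - y n))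
        (+-mono-≤ (bx m n (ℕP.m⊔n≤o⇒m≤o M N p) (ℕP.m⊔n≤o⇒m≤o M N q))
                  (by m n (ℕP.m⊔n≤o⇒n≤o M N p) (ℕP.m⊔n≤o⇒n≤o M N q))))
    where
    eq : ∀ a b c d → (a - c) + (b - d) ≡ (a + b) - (c + d)
    eq = solve 4 (λ a b c d → (a :- c) :+ (b :- d) := (a :+ b) :- (c :+ d)) refl

  neg-cauchy : ∀ x → IsCauchy x → IsCauchy (λ n → - x n)
  neg-cauchy x cx ε 0<ε with cx ε 0<ε
  ... | N , b = N , λ m n p q → subst (_≤ ε) (trans (dist-sym (x m) (x n)) (cong ∣_∣ (eq (x m) (x n)))) (b m n p q)
    where
    eq : ∀ a b → b - a ≡ - a - - b
    eq = solve 2 (λ a b → b :- a := :- a :- :- b) refl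

  abs-cauchy : ∀ x → IsCauchy x → IsCauchy (λ n → ∣ x n ∣)
  abs-cauchy x cx ε 0<ε with cx ε 0<ε
  ... | N , b = N , λ m n p q → ≤-trans (∣∣-lipschitz (x m) (x n)) (b m n p q)

  prefixSum : (ℕ → ℚ) → ℕ → ℚ
  prefixSum x zero    = ∣ x zero ∣
  prefixSum x (suc n) = prefixSum x n + ∣ x (suc n) ∣

  prefixSum-bound : ∀ x N n → n ℕ.≤ N → ∣ x n ∣ ≤ prefixSum x N
  prefixSum-bound x zero .zero z≤n = ≤-refl
  prefixSum-bound x (suc N) n n≤ with ℕP.m≤n⇒m<n∨m≡n n≤
  ... | inj₁ (s≤s n≤N) = subst (_≤ prefixSum x (suc N)) (+-identityʳ ∣ x n ∣)
    (+-mono-≤ (prefixSum-bound x N n n≤N) (0≤∣p∣ (x (suc N))))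
  ... | inj₂ refl = subst (_≤ prefixSum x (suc N)) (+-identityˡ ∣ x (suc N) ∣)
    (+-monoˡ-≤ ∣ x (suc N) ∣ (≤-trans (0≤∣p∣ (x zero)) (prefixSum-bound x N zero z≤n)))

  bounded : ∀ x → IsCauchy x → ∃[ b ] 0ℚ < b × (∀ n → ∣ x n ∣ ≤ b)
  bounded x cx with cx 1ℚ (positive⁻¹ 1ℚ)
  ... | N , h = 1ℚ + prefixSum x N , positive′ , bound
    where
    0≤S : 0ℚ ≤ prefixSum x N
    0≤S = ≤-trans (0≤∣p∣ (x zero)) (prefixSum-bound x N zero z≤n)
    positive′ : 0ℚ < 1ℚ + prefixSum x N
    positive′ = +-mono-<-≤ {0ℚ} {1ℚ} {0ℚ} (positive⁻¹ 1ℚ) 0≤S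
    bound : ∀ n → ∣ x n ∣ ≤ 1ℚ + prefixSum x N
    bound n with ℕP.≤-total n N
    ... | inj₁ n≤N = subst (_≤ 1ℚ + prefixSum x N) (+-identityˡ ∣ x n ∣)
      (+-mono-≤ {0ℚ} {1ℚ} (<⇒≤ (positive⁻¹ 1ℚ)) (prefixSum-bound x N n n≤N))
    ... | inj₂ N≤n = ≤-trans
      (subst (λ t → ∣ t ∣ ≤ ∣ x n - x N ∣ + ∣ x N ∣) (eq (x n) (x N)) (∣p+q∣≤∣p∣+∣q∣ (x n - x N) (x N)))
      (+-mono-≤ (h n N N≤n ℕP.≤-refl) (prefixSum-bound x N N ℕP.≤-refl))
      where
      eq : ∀ a b → (a - b) + b ≡ a
      eq = solve 2 (λ a b → (a :- b) :+ b := a) refl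

  *-cauchy : ∀ x y → IsCauchy x → IsCauchy y → IsCauchy (λ n → x n * y n)
  *-cauchy x y cx cy with bounded x cx | bounded y cy
  ... | a , 0<a , ha | b , 0<b , hb = scaled (λ n → x n * y n) (a + b) (+-mono-< 0<a 0<b) go
    where
    go : ∀ ε → 0ℚ < ε → ∃[ N ] ∀ m n → N ℕ.≤ m → N ℕ.≤ n → ∣ x m * y m - x n * y n ∣ ≤ (a + b) * ε
    go ε 0<ε with cx ε 0<ε | cy ε 0<ε
    ... | M , bx | N , by = M ℕ.⊔ N , λ m n p q →
      subst₂ _≤_ (cong ∣_∣ (eq (x m) (y m) (x n) (y n))) (sym (*-distribʳ-+ ε a b))
        (≤-trans (∣p+q∣≤∣p∣+∣q∣ (x m * (y m - y n)) (y n * (x m - x n)))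
          (+-mono-≤
            (subst (_≤ a * ε) (sym (∣p*q∣≡∣p∣*∣q∣ (x m) (y m - y n)))
              (*-mono-≤ (0≤∣p∣ _) (<⇒≤ 0<a) (ha m) (by m n (ℕP.m⊔n≤o⇒n≤o M N p) (ℕP.m⊔n≤o⇒n≤o M N q))))
            (subst (_≤ b * ε) (sym (∣p*q∣≡∣p∣*∣q∣ (y n) (x m - x n)))
              (*-mono-≤ (0≤∣p∣ _) (<⇒≤ 0<b) (hb n) (bx m n (ℕP.m⊔n≤o⇒m≤o M N p) (ℕP.m⊔n≤o⇒m≤o M N q))))))
      where
      eq : ∀ a b c d → a * (b - d) + d * (a - c) ≡ a * b - c * d
      eq = solve 4 (λ a b c d → a :* (b :- d) :+ d :* (a :- c) := a :* b :- c :* d) refl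

open CauchyLemmas

infix  8 -ᴿ_
infixl 7 _*ᴿ_
infixl 6 _+ᴿ_ _-ᴿ_

fromℚ : ℚ → ℝ
fromℚ q = mkℝ (λ _ → q) (const-cauchy q)

fromℕ : ℕ → ℝ
fromℕ n = fromℚ (+ n / 1)

0ᴿ 1ᴿ 2ᴿ : ℝ
0ᴿ = fromℕ 0
1ᴿ = fromℕ 1
2ᴿ = fromℕ 2

-ᴿ_ ∣_∣ᴿ : ℝ → ℝ
-ᴿ x = mkℝ (λ n → - seq x n) (neg-cauchy (seq x) (isCauchy x))
∣ x ∣ᴿ = mkℝ (λ n → ∣ seq x n ∣) (abs-cauchy (seq x) (isCauchy x))

_+ᴿ_ _*ᴿ_ _-ᴿ_ : ℝ → ℝ → ℝ
x +ᴿ y = mkℝ (λ n → seq x n + seq y n) (+-cauchy (seq x) (seq y) (isCauchy x) (isCauchy y))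
x *ᴿ y = mkℝ (λ n → seq x n * seq y n) (*-cauchy (seq x) (seq y) (isCauchy x) (isCauchy y))
x -ᴿ y = x +ᴿ (-ᴿ y)

module ReciprocalLemmas where

  1/-anti : ∀ δ a (0<δ : 0ℚ < δ) (0<a : 0ℚ < a) → δ ≤ a → (1/ a) {{>-nonZero 0<a}} ≤ (1/ δ) {{>-nonZero 0<δ}}
  1/-anti δ a 0<δ 0<a δ≤a = subst₂ _≤_
    (trans (*-assoc 1/a δ 1/δ) (trans (cong (1/a *_) (*-inverseʳ δ {{>-nonZero 0<δ}})) (*-identityʳ 1/a)))
    (trans (cong (_* 1/δ) (*-inverseˡ a {{>-nonZero 0<a}})) (*-identityˡ 1/δ))
    (*-monoʳ-≤-nonNeg 1/δ {{nonNegative (<⇒≤ (0<1/ δ 0<δ))}}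
      (*-monoˡ-≤-nonNeg 1/a {{nonNegative (<⇒≤ (0<1/ a 0<a))}} δ≤a))
    where
    1/a = (1/ a) {{>-nonZero 0<a}}
    1/δ = (1/ δ) {{>-nonZero 0<δ}}

  1/-diff : ∀ a b (0<a : 0ℚ < a) (0<b : 0ℚ < b) →
    (1/ a) {{>-nonZero 0<a}} - (1/ b) {{>-nonZero 0<b}} ≡
    ((1/ a) {{>-nonZero 0<a}} * (1/ b) {{>-nonZero 0<b}}) * (b - a)
  1/-diff a b 0<a 0<b = sym (trans (expand 1/a 1/b a b)
    (cong₂ _-_ (trans (cong (1/a *_) (*-inverseˡ b {{>-nonZero 0<b}})) (*-identityʳ 1/a))
               (trans (cong (1/b *_) (*-inverseˡ a {{>-nonZero 0<a}})) (*-identityʳ 1/b))))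
    where
    1/a = (1/ a) {{>-nonZero 0<a}}
    1/b = (1/ b) {{>-nonZero 0<b}}
    expand : ∀ p q a b → (p * q) * (b - a) ≡ p * (q * b) - q * (p * a)
    expand = solve 4 (λ p q a b → (p :* q) :* (b :- a) := p :* (q :* b) :- q :* (p :* a)) refl

  tail-positive : ∀ x (0<x : 0ᴿ <ᴿ x) n → 0ℚ < seq x (proj₁ (proj₂ (proj₂ 0<x)) ℕ.+ n)
  tail-positive x (δ , 0<δ , N , h) n = <-≤-trans 0<δ
    (subst (_≤ seq x (N ℕ.+ n)) (+-identityˡ δ) (h (N ℕ.+ n) (ℕP.m≤m+n N n)))

open ReciprocalLemmas

-- Terms before the index from which the positivity witness bounds x away from 0
-- are dropped, so that every term can be inverted.
reciprocal : (x : ℝ) → 0ᴿ <ᴿ x → ℝ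
reciprocal x 0<x@(δ , 0<δ , N , h) = mkℝ inv (scaled inv (1/δ * 1/δ) (0<* 0<1/δ 0<1/δ) cauchy)
  where
  inv : ℕ → ℚ
  inv n = (1/ seq x (N ℕ.+ n)) {{>-nonZero (tail-positive x 0<x n)}}
  1/δ = (1/ δ) {{>-nonZero 0<δ}}
  0<1/δ = 0<1/ δ 0<δ
  inv≤ : ∀ n → inv n ≤ 1/δ
  inv≤ n = 1/-anti δ _ 0<δ (tail-positive x 0<x n)
    (subst (_≤ seq x (N ℕ.+ n)) (+-identityˡ δ) (h (N ℕ.+ n) (ℕP.m≤m+n N n)))
  0≤inv : ∀ n → 0ℚ ≤ inv n
  0≤inv n = <⇒≤ (0<1/ _ (tail-positive x 0<x n))
  cauchy : ∀ ε → 0ℚ < ε → ∃[ K ] ∀ m n → K ℕ.≤ m → K ℕ.≤ n → ∣ inv m - inv n ∣ ≤ (1/δ * 1/δ) * ε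
  cauchy ε 0<ε with isCauchy x ε 0<ε
  ... | K , b = K , λ m n p q → subst (_≤ (1/δ * 1/δ) * ε)
    (sym (trans (cong ∣_∣ (1/-diff _ _ (tail-positive x 0<x m) (tail-positive x 0<x n)))
      (trans (∣p*q∣≡∣p∣*∣q∣ (inv m * inv n) (seq x (N ℕ.+ n) - seq x (N ℕ.+ m)))
        (cong (_* ∣ seq x (N ℕ.+ n) - seq x (N ℕ.+ m) ∣) (0≤p⇒∣p∣≡p (0≤* (0≤inv m) (0≤inv n)))))))
    (*-mono-≤ (0≤∣p∣ _) (0≤* (<⇒≤ 0<1/δ) (<⇒≤ 0<1/δ))
      (*-mono-≤ (0≤inv n) (<⇒≤ 0<1/δ) (inv≤ m) (inv≤ n))
      (b (N ℕ.+ n) (N ℕ.+ m) (ℕP.≤-trans q (ℕP.m≤n+m n N)) (ℕP.≤-trans p (ℕP.m≤n+m m N))))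

IsCauchyᴿ : (ℕ → ℝ) → Set
IsCauchyᴿ f = ∀ ε → 0ℚ < ε → ∃[ N ] ∀ m n → N ℕ.≤ m → N ℕ.≤ n → ∣ f m -ᴿ f n ∣ᴿ ≤ᴿ fromℚ ε

-- The n-th term of the limit approximates f n to within 1/(n+1).
lim : (f : ℕ → ℝ) → IsCauchyᴿ f → ℝ
lim f cf = mkℝ diag cauchy
  where
  index : ℕ → ℕ
  index n = proj₁ (isCauchy (f n) (recip n) (0<recip n))
  diag : ℕ → ℚ
  diag n = seq (f n) (index n)
  near : ∀ n i → index n ℕ.≤ i → ∣ diag n - seq (f n) i ∣ ≤ recip n
  near n i p = proj₂ (isCauchy (f n) (recip n) (0<recip n)) (index n) i ℕP.≤-refl p
  regroup : ∀ a → a + ((a + a) + a) ≡ (a + a) + (a + a)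
  regroup = solve 1 (λ a → a :+ ((a :+ a) :+ a) := (a :+ a) :+ (a :+ a)) refl
  sum4 : ∀ ε → ½ * (½ * ε) + ((½ * (½ * ε) + ½ * (½ * ε)) + ½ * (½ * ε)) ≡ ε
  sum4 ε = trans (regroup (½ * (½ * ε))) (trans (cong₂ _+_ (half (½ * ε)) (half (½ * ε))) (half ε))
  cauchy : IsCauchy diag
  cauchy ε 0<ε with cf (½ * (½ * ε)) (0<* 0<½ (0<* 0<½ 0<ε)) | archimedean (½ * (½ * ε)) (0<* 0<½ (0<* 0<½ 0<ε))
  ... | N , close | A , small = N ℕ.⊔ A , bound
    where
    η = ½ * (½ * ε)
    bound : ∀ m n → N ℕ.⊔ A ℕ.≤ m → N ℕ.⊔ A ℕ.≤ n → ∣ diag m - diag n ∣ ≤ ε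
    bound m n p q with close m n (ℕP.m⊔n≤o⇒m≤o N A p) (ℕP.m⊔n≤o⇒m≤o N A q) η (0<* 0<½ (0<* 0<½ 0<ε))
    ... | K , h = subst (∣ diag m - diag n ∣ ≤_) (sum4 ε)
      (≤-trans (triangle (diag m) (seq (f m) i) (diag n))
        (+-mono-≤ (≤-trans (near m i index-m≤i) (small m (ℕP.m⊔n≤o⇒n≤o N A p)))
          (≤-trans (triangle (seq (f m) i) (seq (f n) i) (diag n))
            (+-mono-≤ (h i K≤i)
              (subst (_≤ η) (dist-sym (diag n) (seq (f n) i))
                (≤-trans (near n i index-n≤i) (small n (ℕP.m⊔n≤o⇒n≤o N A q))))))))
      where
      i : ℕ
      i = K ℕ.+ (index m ℕ.+ index n)
      K≤i : K ℕ.≤ i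
      K≤i = ℕP.m≤m+n K _
      index-m≤i : index m ℕ.≤ i
      index-m≤i = ℕP.≤-trans (ℕP.m≤m+n (index m) (index n)) (ℕP.m≤n+m _ K)
      index-n≤i : index n ℕ.≤ i
      index-n≤i = ℕP.≤-trans (ℕP.m≤n+m (index n) (index m)) (ℕP.m≤n+m _ K)

-- qᵏ / k!
expTerm : ℚ → ℕ → ℚ
expTerm q zero    = 1ℚ
expTerm q (suc k) = expTerm q k * (q * (+ 1 / suc k))

expSum : ℚ → ℕ → ℚ
expSum q zero    = expTerm q zero
expSum q (suc n) = expSum q n + expTerm q (suc n)

module ExpLemmas where

  0≤recip : ∀ n → 0ℚ ≤ recip n
  0≤recip n = <⇒≤ (0<recip n)

  r*recip : ∀ k → r (suc k) * recip k ≡ 1ℚ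
  r*recip k = trans (cong (λ t → r (suc k) * recip t) (sym (ℕP.*-identityʳ k))) (recip-scale k 0)

  module _ (b : ℚ) (0≤b : 0ℚ ≤ b) where

    private
      t = expTerm b

    0≤t : ∀ k → 0ℚ ≤ t k
    0≤t zero    = <⇒≤ (positive⁻¹ 1ℚ)
    0≤t (suc k) = 0≤* (0≤t k) (0≤* 0≤b (0≤recip k))

    ∣q*recip∣≤ : ∀ q k → ∣ q ∣ ≤ b → ∣ q * recip k ∣ ≤ b * recip k
    ∣q*recip∣≤ q k h = subst (_≤ b * recip k)
      (sym (trans (∣p*q∣≡∣p∣*∣q∣ q (recip k)) (cong (∣ q ∣ *_) (0≤p⇒∣p∣≡p (0≤recip k)))))
      (*-mono-≤ (0≤recip k) 0≤b h ≤-refl)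

    term≤t : ∀ q → ∣ q ∣ ≤ b → ∀ k → ∣ expTerm q k ∣ ≤ t k
    term≤t q h zero    = ≤-refl
    term≤t q h (suc k) = subst (_≤ t (suc k)) (sym (∣p*q∣≡∣p∣*∣q∣ (expTerm q k) (q * recip k)))
      (*-mono-≤ (0≤∣p∣ _) (0≤t k) (term≤t q h k) (∣q*recip∣≤ q k h))

    -- bᵏ⁻¹/(k-1)! is a Lipschitz constant of qᵏ/k! on [-b , b]
    lip : ℕ → ℚ
    lip zero    = 0ℚ
    lip (suc k) = t k

    lip-suc : ∀ k → lip k * (b * recip k) + t k * recip k ≡ t k
    lip-suc zero    = trans (cong (_+ 1ℚ * recip 0) (*-zeroˡ (b * recip 0))) refl
    lip-suc (suc k) = trans (expand (t k) b (recip k) (recip (suc k)))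
      (trans (cong (λ z → (t k * b) * (recip (suc k) * (z + recip k))) (sym (r*recip k)))
        (trans (expand′ (t k) b (recip k) (recip (suc k)) (r (suc k)))
          (trans (cong (λ z → (t k * (b * recip k)) * (z * recip (suc k))) (sym (r-suc (suc k))))
            (trans (cong ((t k * (b * recip k)) *_) (r*recip (suc k))) (*-identityʳ _)))))
      where
      expand : ∀ t b ρ σ → t * (b * σ) + (t * (b * ρ)) * σ ≡ (t * b) * (σ * (1ℚ + ρ))
      expand = solve 4 (λ t b ρ σ → t :* (b :* σ) :+ (t :* (b :* ρ)) :* σ := (t :* b) :* (σ :* (con 1ℚ :+ ρ))) refl
      expand′ : ∀ t b ρ σ s → (t * b) * (σ * (s * ρ + ρ)) ≡ (t * (b * ρ)) * ((s + 1ℚ) * σ)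
      expand′ = solve 5 (λ t b ρ σ s → (t :* b) :* (σ :* (s :* ρ :+ ρ)) := (t :* (b :* ρ)) :* ((s :+ con 1ℚ) :* σ)) refl

    0≤lip : ∀ k → 0ℚ ≤ lip k
    0≤lip zero    = ≤-refl
    0≤lip (suc k) = 0≤t k

    term-lipschitz : ∀ p q → ∣ p ∣ ≤ b → ∣ q ∣ ≤ b → ∀ k → ∣ expTerm p k - expTerm q k ∣ ≤ lip k * ∣ p - q ∣
    term-lipschitz p q hp hq zero    = ≤-reflexive (trans (dist-refl 1ℚ) (sym (*-zeroˡ ∣ p - q ∣)))
    term-lipschitz p q hp hq (suc k) = subst₂ _≤_
      (cong ∣_∣ (split (expTerm p k) (expTerm q k) p q (recip k)))
      (trans (collect (lip k) b (recip k) (t k) ∣ p - q ∣) (cong (_* ∣ p - q ∣) (lip-suc k)))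
      (≤-trans (∣p+q∣≤∣p∣+∣q∣ ((expTerm p k - expTerm q k) * (p * recip k)) (expTerm q k * ((p - q) * recip k))) (+-mono-≤
        (subst (_≤ (lip k * ∣ p - q ∣) * (b * recip k)) (sym (∣p*q∣≡∣p∣*∣q∣ (expTerm p k - expTerm q k) (p * recip k)))
          (*-mono-≤ (0≤∣p∣ _) (0≤* (0≤lip k) (0≤∣p∣ _)) (term-lipschitz p q hp hq k) (∣q*recip∣≤ p k hp)))
        (subst (_≤ t k * (∣ p - q ∣ * recip k)) (sym (∣p*q∣≡∣p∣*∣q∣ (expTerm q k) ((p - q) * recip k)))
          (*-mono-≤ (0≤∣p∣ _) (0≤t k) (term≤t q hq k)
            (≤-reflexive (trans (∣p*q∣≡∣p∣*∣q∣ (p - q) (recip k)) (cong (∣ p - q ∣ *_) (0≤p⇒∣p∣≡p (0≤recip k)))))))))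
      where
      split : ∀ s u p q ρ → (s - u) * (p * ρ) + u * ((p - q) * ρ) ≡ s * (p * ρ) - u * (q * ρ)
      split = solve 5 (λ s u p q ρ → (s :- u) :* (p :* ρ) :+ u :* ((p :- q) :* ρ) := s :* (p :* ρ) :- u :* (q :* ρ)) refl
      collect : ∀ l b ρ t d → (l * d) * (b * ρ) + t * (d * ρ) ≡ (l * (b * ρ) + t * ρ) * d
      collect = solve 5 (λ l b ρ t d → (l :* d) :* (b :* ρ) :+ t :* (d :* ρ) := (l :* (b :* ρ) :+ t :* ρ) :* d) refl

    sum-lipschitz : ∀ p q → ∣ p ∣ ≤ b → ∣ q ∣ ≤ b → ∀ n → ∣ expSum p n - expSum q n ∣ ≤ expSum b n * ∣ p - q ∣
    sum-lipschitz p q hp hq n = ≤-trans (go n) (*-monoʳ-≤-nonNeg ∣ p - q ∣ {{nonNegative (0≤∣p∣ (p - q))}} (L≤ n))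
      where
      L : ℕ → ℚ
      L zero    = 0ℚ
      L (suc n) = expSum b n
      L≤ : ∀ n → L n ≤ expSum b n
      L≤ zero    = <⇒≤ (positive⁻¹ 1ℚ)
      L≤ (suc n) = subst (_≤ expSum b (suc n)) (+-identityʳ _) (+-monoʳ-≤ (expSum b n) (0≤t (suc n)))
      L-suc : ∀ n → L n + lip (suc n) ≡ L (suc n)
      L-suc zero    = +-identityˡ _
      L-suc (suc n) = refl
      regroup : ∀ a b c d → (a - c) + (b - d) ≡ (a + b) - (c + d)
      regroup = solve 4 (λ a b c d → (a :- c) :+ (b :- d) := (a :+ b) :- (c :+ d)) refl
      go : ∀ n → ∣ expSum p n - expSum q n ∣ ≤ L n * ∣ p - q ∣
      go zero    = ≤-reflexive (trans (dist-refl 1ℚ) (sym (*-zeroˡ ∣ p - q ∣)))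
      go (suc n) = subst₂ _≤_
        (cong ∣_∣ (regroup (expSum p n) (expTerm p (suc n)) (expSum q n) (expTerm q (suc n))))
        (trans (sym (*-distribʳ-+ ∣ p - q ∣ (L n) (lip (suc n)))) (cong (_* ∣ p - q ∣) (L-suc n)))
        (≤-trans (∣p+q∣≤∣p∣+∣q∣ (expSum p n - expSum q n) (expTerm p (suc n) - expTerm q (suc n))) (+-mono-≤ (go n) (term-lipschitz p q hp hq (suc n))))

    sum-tail : ∀ q → ∣ q ∣ ≤ b → ∀ m d → ∣ expSum q (d ℕ.+ m) - expSum q m ∣ ≤ expSum b (d ℕ.+ m) - expSum b m
    sum-tail q h m zero    = ≤-reflexive (trans (dist-refl (expSum q m)) (sym (+-inverseʳ (expSum b m))))
    sum-tail q h m (suc d) = subst₂ _≤_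
      (cong ∣_∣ (regroup (expSum q (d ℕ.+ m)) (expSum q m) (expTerm q (suc (d ℕ.+ m)))))
      (regroup (expSum b (d ℕ.+ m)) (expSum b m) (t (suc (d ℕ.+ m))))
      (≤-trans (∣p+q∣≤∣p∣+∣q∣ (expSum q (d ℕ.+ m) - expSum q m) (expTerm q (suc (d ℕ.+ m)))) (+-mono-≤ (sum-tail q h m d) (term≤t q h (suc (d ℕ.+ m)))))
      where
      regroup : ∀ a c e → (a - c) + e ≡ (a + e) - c
      regroup = solve 3 (λ a c e → (a :- c) :+ e := (a :+ e) :- c) refl

    -- from the index K on, the terms of the series at least halve
    module _ (K : ℕ) (halving : ∀ n → K ℕ.≤ n → b * recip n ≤ ½) where

      t-half : ∀ i → t (suc (i ℕ.+ K)) ≤ t (i ℕ.+ K) * ½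
      t-half i = *-monoˡ-≤-nonNeg (t (i ℕ.+ K)) {{nonNegative (0≤t (i ℕ.+ K))}} (halving (i ℕ.+ K) (ℕP.m≤n+m K i))

      t-small : ∀ i → t (i ℕ.+ K) ≤ t K * recip i
      t-small zero    = ≤-reflexive (sym (*-identityʳ (t K)))
      t-small (suc i) = ≤-trans (t-half i) (≤-trans (*-monoʳ-≤-nonNeg ½ (t-small i))
        (subst (_≤ t K * recip (suc i)) (assoc (t K) (recip i))
          (*-monoˡ-≤-nonNeg (t K) {{nonNegative (0≤t K)}} (½recip≤ i))))
        where
        assoc : ∀ t ρ → t * (½ * ρ) ≡ (t * ρ) * ½
        assoc = solve 2 (λ t ρ → t :* (con ½ :* ρ) := (t :* ρ) :* con ½) refl

      upper-decr : ∀ i d → expSum b (d ℕ.+ (i ℕ.+ K)) + t (d ℕ.+ (i ℕ.+ K)) ≤ expSum b (i ℕ.+ K) + t (i ℕ.+ K)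
      upper-decr i zero    = ≤-refl
      upper-decr i (suc d) = ≤-trans
        (subst (_≤ E + t n) (sym (+-assoc E (t (suc n)) (t (suc n))))
          (+-monoʳ-≤ E (subst₂ _≤_ refl (trans (cong₂ _+_ (*-comm (t n) ½) (*-comm (t n) ½)) (half (t n)))
            (+-mono-≤ half′ half′))))
        (upper-decr i d)
        where
        n = d ℕ.+ (i ℕ.+ K)
        E = expSum b n
        half′ : t (suc n) ≤ t n * ½
        half′ = subst (λ z → t (suc z) ≤ t z * ½) (ℕP.+-assoc d i K) (t-half (d ℕ.+ i))

      tail-small : ∀ i d → expSum b (d ℕ.+ (i ℕ.+ K)) - expSum b (i ℕ.+ K) ≤ t K * recip i
      tail-small i d = ≤-trans (subst₂ _≤_ refl (cancel (expSum b m) (t m))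
        (+-monoˡ-≤ (- expSum b m) (≤-trans
          (subst (_≤ expSum b (d ℕ.+ m) + t (d ℕ.+ m)) (+-identityʳ (expSum b (d ℕ.+ m))) (+-monoʳ-≤ (expSum b (d ℕ.+ m)) (0≤t (d ℕ.+ m))))
          (upper-decr i d)))) (t-small i)
        where
        m = i ℕ.+ K
        cancel : ∀ e t → (e + t) - e ≡ t
        cancel = solve 2 (λ e t → (e :+ t) :- e := t) refl

      sum-incr : ∀ m d → expSum b m ≤ expSum b (d ℕ.+ m)
      sum-incr m zero    = ≤-refl
      sum-incr m (suc d) = subst (_≤ expSum b (suc d ℕ.+ m)) (+-identityʳ (expSum b m))
        (+-mono-≤ (sum-incr m d) (0≤t (suc (d ℕ.+ m))))

      sum-bounded : ∀ m → expSum b m ≤ expSum b K + t K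
      sum-bounded m = ≤-trans (subst (λ z → expSum b m ≤ expSum b z) (ℕP.+-comm K m) (sum-incr m K))
        (≤-trans (subst (_≤ expSum b (m ℕ.+ K) + t (m ℕ.+ K)) (+-identityʳ (expSum b (m ℕ.+ K))) (+-monoʳ-≤ (expSum b (m ℕ.+ K)) (0≤t (m ℕ.+ K))))
          (upper-decr 0 m))

open ExpLemmas

module ExpCauchy where

  module _ (x : ℕ → ℚ) (cx : IsCauchy x) (b : ℚ) (0≤b : 0ℚ ≤ b) (hb : ∀ n → ∣ x n ∣ ≤ b)
           (K : ℕ) (halving : ∀ n → K ℕ.≤ n → b * recip n ≤ ½)
           (S : ℚ) (0<S : 0ℚ < S) (sum≤S : ∀ n → expSum b n ≤ S) (T≤S : expTerm b K ≤ S) where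

    private
      y : ℕ → ℚ
      y n = expSum (x n) n
      T : ℚ
      T = expTerm b K

    exp-close : ∀ ε → 0ℚ < ε → ∃[ N ] ∀ m n → N ℕ.≤ m → m ℕ.≤ n → ∣ y m - y n ∣ ≤ ε
    exp-close ε 0<ε = M ℕ.⊔ (A ℕ.+ K) , bound
      where
      1/S η : ℚ
      1/S = (1/ S) {{>-nonZero 0<S}}
      η = 1/S * (½ * ε)
      0<η : 0ℚ < η
      0<η = 0<* (0<1/ S 0<S) (0<* 0<½ 0<ε)
      M A : ℕ
      M = proj₁ (cx η 0<η)
      A = proj₁ (archimedean η 0<η)
      near : ∀ m n → M ℕ.≤ m → M ℕ.≤ n → ∣ x m - x n ∣ ≤ η
      near = proj₂ (cx η 0<η)
      tiny : ∀ n → A ℕ.≤ n → recip n ≤ η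
      tiny = proj₂ (archimedean η 0<η)
      Sη : S * η ≡ ½ * ε
      Sη = trans (sym (*-assoc S 1/S (½ * ε)))
        (trans (cong (_* (½ * ε)) (*-inverseʳ S {{>-nonZero 0<S}})) (*-identityˡ (½ * ε)))
      bound : ∀ m n → M ℕ.⊔ (A ℕ.+ K) ℕ.≤ m → m ℕ.≤ n → ∣ y m - y n ∣ ≤ ε
      bound m n p m≤n = subst (∣ y m - y n ∣ ≤_) (half ε)
        (≤-trans (triangle (expSum (x m) m) (expSum (x n) m) (expSum (x n) n)) (+-mono-≤ first second))
        where
        first : ∣ expSum (x m) m - expSum (x n) m ∣ ≤ ½ * ε
        first = subst (∣ expSum (x m) m - expSum (x n) m ∣ ≤_) Sη
          (≤-trans (sum-lipschitz b 0≤b (x m) (x n) (hb m) (hb n) m)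
            (*-mono-≤ (0≤∣p∣ _) (<⇒≤ 0<S) (sum≤S m)
              (near m n (ℕP.m⊔n≤o⇒m≤o M (A ℕ.+ K) p) (ℕP.≤-trans (ℕP.m⊔n≤o⇒m≤o M (A ℕ.+ K) p) m≤n))))
        K≤m : K ℕ.≤ m
        K≤m = ℕP.≤-trans (ℕP.m≤n+m K A) (ℕP.m⊔n≤o⇒n≤o M (A ℕ.+ K) p)
        i d : ℕ
        i = m ℕ.∸ K
        d = n ℕ.∸ m
        iK : i ℕ.+ K ≡ m
        iK = ℕP.m∸n+n≡m K≤m
        dm : d ℕ.+ m ≡ n
        dm = ℕP.m∸n+n≡m m≤n
        A≤i : A ℕ.≤ i
        A≤i = subst (ℕ._≤ i) (ℕP.m+n∸n≡m A K) (ℕP.∸-monoˡ-≤ K (ℕP.m⊔n≤o⇒n≤o M (A ℕ.+ K) p))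
        second : ∣ expSum (x n) m - expSum (x n) n ∣ ≤ ½ * ε
        second = subst₂ _≤_ (dist-sym (expSum (x n) n) (expSum (x n) m)) Sη
          (≤-trans (subst (λ z → ∣ expSum (x n) z - expSum (x n) m ∣ ≤ expSum b z - expSum b m) dm
                     (sum-tail b 0≤b (x n) (hb n) m d))
            (≤-trans (subst₂ (λ z w → expSum b z - expSum b w ≤ T * recip i) (trans (cong (d ℕ.+_) iK) dm) iK
                       (tail-small b 0≤b K halving i d))
              (*-mono-≤ (0≤recip i) (<⇒≤ 0<S) T≤S (tiny i A≤i))))

  exp-cauchy : ∀ x → IsCauchy x → IsCauchy (λ n → expSum (x n) n)
  exp-cauchy x cx = ordered (λ n → expSum (x n) n)
    (exp-close x cx b 0≤b hb K halving (expSum b K + expTerm b K) 0<S (sum-bounded b 0≤b K halving) T≤S)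
    where
    b : ℚ
    b = proj₁ (bounded x cx)
    0<b : 0ℚ < b
    0<b = proj₁ (proj₂ (bounded x cx))
    hb : ∀ n → ∣ x n ∣ ≤ b
    hb = proj₂ (proj₂ (bounded x cx))
    0≤b : 0ℚ ≤ b
    0≤b = <⇒≤ 0<b
    1/b : ℚ
    1/b = (1/ b) {{>-nonZero 0<b}}
    arch : ∃[ N ] ∀ n → N ℕ.≤ n → recip n ≤ ½ * 1/b
    arch = archimedean (½ * 1/b) (0<* 0<½ (0<1/ b 0<b))
    K : ℕ
    K = proj₁ arch
    assoc : ∀ b c → b * (½ * c) ≡ ½ * (b * c)
    assoc = solve 2 (λ b c → b :* (con ½ :* c) := con ½ :* (b :* c)) refl
    halving : ∀ n → K ℕ.≤ n → b * recip n ≤ ½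
    halving n K≤n = subst (b * recip n ≤_)
      (trans (assoc b 1/b) (trans (cong (½ *_) (*-inverseʳ b {{>-nonZero 0<b}})) (*-identityʳ ½)))
      (*-monoˡ-≤-nonNeg b {{nonNegative 0≤b}} (proj₂ arch n K≤n))
    0<S : 0ℚ < expSum b K + expTerm b K
    0<S = <-≤-trans (positive⁻¹ 1ℚ) (sum-bounded b 0≤b K halving 0)
    0≤E : 0ℚ ≤ expSum b K
    0≤E = ≤-trans {0ℚ} {expSum b 0} (<⇒≤ (positive⁻¹ 1ℚ))
      (subst (λ z → expSum b 0 ≤ expSum b z) (ℕP.+-identityʳ K) (sum-incr b 0≤b K halving 0 K))
    T≤S : expTerm b K ≤ expSum b K + expTerm b K
    T≤S = subst (_≤ expSum b K + expTerm b K) (+-identityˡ (expTerm b K)) (+-monoˡ-≤ (expTerm b K) 0≤E)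

open ExpCauchy

-- exp x = ∑ xᵏ/k!, the n-th approximation being ∑_{k ≤ n} (xₙ)ᵏ/k!.
exp : ℝ → ℝ
exp x = mkℝ (λ n → expSum (seq x n) n) (exp-cauchy (seq x) (isCauchy x))

harmonic : ℕ → ℚ
harmonic zero    = 0ℚ
harmonic (suc n) = harmonic n + + 1 / suc n

module BlockLemmas where

  block-upper : ∀ c k → harmonic (k ℕ.+ suc c) - harmonic (suc c) ≤ r k * recip c
  block-upper c zero    = ≤-reflexive (trans (+-inverseʳ (harmonic (suc c))) (sym (*-zeroˡ (recip c))))
  block-upper c (suc k) = subst₂ _≤_
    (regroup (harmonic (k ℕ.+ suc c)) (harmonic (suc c)) (recip (k ℕ.+ suc c)))
    (trans (distrib (r k) (recip c)) (cong (_* recip c) (sym (r-suc k))))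
    (+-mono-≤ (block-upper c k) (recip-anti (ℕP.≤-trans (ℕP.n≤1+n c) (ℕP.m≤n+m (suc c) k))))
    where
    regroup : ∀ a b e → (a - b) + e ≡ (a + e) - b
    regroup = solve 3 (λ a b e → (a :- b) :+ e := (a :+ e) :- b) refl
    distrib : ∀ a b → a * b + b ≡ (a + 1ℚ) * b
    distrib = solve 2 (λ a b → a :* b :+ b := (a :+ con 1ℚ) :* b) refl

  block-lower : ∀ c l k → k ℕ.≤ suc l → r k * recip (l ℕ.+ suc c) ≤ harmonic (k ℕ.+ suc c) - harmonic (suc c)
  block-lower c l zero    _ = ≤-reflexive (trans (*-zeroˡ (recip (l ℕ.+ suc c))) (sym (+-inverseʳ (harmonic (suc c)))))
  block-lower c l (suc k) (s≤s k≤l) = subst₂ _≤_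
    (trans (distrib (r k) (recip (l ℕ.+ suc c))) (cong (_* recip (l ℕ.+ suc c)) (sym (r-suc k))))
    (regroup (harmonic (k ℕ.+ suc c)) (harmonic (suc c)) (recip (k ℕ.+ suc c)))
    (+-mono-≤ (block-lower c l k (ℕP.≤-trans k≤l (ℕP.n≤1+n l))) (recip-anti (ℕP.+-monoˡ-≤ (suc c) k≤l)))
    where
    regroup : ∀ a b e → (a - b) + e ≡ (a + e) - b
    regroup = solve 3 (λ a b e → (a :- b) :+ e := (a :+ e) :- b) refl
    distrib : ∀ a b → a * b + b ≡ (a + 1ℚ) * b
    distrib = solve 2 (λ a b → a :* b :+ b := (a :+ con 1ℚ) :* b) refl

open BlockLemmas

-- ∑_{n < i ≤ Nn} 1/i is the n-th lower Riemann sum of ∫₁ᴺ dt/t, with mesh 1/n.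
lnSum : ℕ → ℕ → ℚ
lnSum N n = harmonic (N ℕ.* n) - harmonic n

module LnLemmas where

  module _ (j : ℕ) where

    private
      F : ℕ → ℚ
      F = lnSum (suc j)

      J : ℕ → ℚ
      J a = harmonic (suc j ℕ.+ suc j ℕ.* suc a) - harmonic (suc j ℕ.* suc a)

    F-suc : ∀ a → F (suc (suc a)) - F (suc a) ≡ J a - recip (suc a)
    F-suc a = trans (cong (λ z → (harmonic z - harmonic (suc (suc a))) - F (suc a)) (ℕP.*-suc (suc j) (suc a)))
      (regroup (harmonic (suc j ℕ.+ suc j ℕ.* suc a)) (harmonic (suc a)) (recip (suc a)) (harmonic (suc j ℕ.* suc a)))
      where
      regroup : ∀ p h e q → (p - (h + e)) - (q - h) ≡ (p - q) - e
      regroup = solve 4 (λ p h e q → (p :- (h :+ e)) :- (q :- h) := (p :- q) :- e) refl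

    J≤ : ∀ a → J a ≤ recip a
    J≤ a = subst (J a ≤_) (recip-scale j a) (block-upper (a ℕ.+ j ℕ.* suc a) (suc j))

    ≤J : ∀ a → recip (suc a) ≤ J a
    ≤J a = subst (_≤ J a)
      (trans (cong (λ z → r (suc j) * recip z) (ℕP.suc-injective (sym (ℕP.*-suc (suc j) (suc a)))))
             (recip-scale j (suc a)))
      (block-lower (a ℕ.+ j ℕ.* suc a) j (suc j) ℕP.≤-refl)

    step-lower : ∀ a → 0ℚ ≤ F (suc (suc a)) - F (suc a)
    step-lower a = subst₂ _≤_ (+-inverseʳ (recip (suc a))) (sym (F-suc a)) (+-monoˡ-≤ (- recip (suc a)) (≤J a))

    step-upper : ∀ a → F (suc (suc a)) - F (suc a) ≤ recip a - recip (suc a)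
    step-upper a = subst (_≤ recip a - recip (suc a)) (sym (F-suc a)) (+-monoˡ-≤ (- recip (suc a)) (J≤ a))

    F-lower : ∀ a d → 0ℚ ≤ F (suc (d ℕ.+ a)) - F (suc a)
    F-lower a zero    = ≤-reflexive (sym (+-inverseʳ (F (suc a))))
    F-lower a (suc d) = subst (0ℚ ≤_) (telescope (F (suc (suc (d ℕ.+ a)))) (F (suc (d ℕ.+ a))) (F (suc a)))
      (+-mono-≤ (step-lower (d ℕ.+ a)) (F-lower a d))
      where
      telescope : ∀ p q s → (p - q) + (q - s) ≡ p - s
      telescope = solve 3 (λ p q s → (p :- q) :+ (q :- s) := p :- s) refl

    F-upper : ∀ a d → F (suc (d ℕ.+ a)) - F (suc a) ≤ recip a - recip (d ℕ.+ a)
    F-upper a zero    = ≤-reflexive (trans (+-inverseʳ (F (suc a))) (sym (+-inverseʳ (recip a))))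
    F-upper a (suc d) = subst₂ _≤_
      (telescope (F (suc (suc (d ℕ.+ a)))) (F (suc (d ℕ.+ a))) (F (suc a)))
      (telescope′ (recip a) (recip (d ℕ.+ a)) (recip (suc (d ℕ.+ a))))
      (+-mono-≤ (step-upper (d ℕ.+ a)) (F-upper a d))
      where
      telescope : ∀ p q s → (p - q) + (q - s) ≡ p - s
      telescope = solve 3 (λ p q s → (p :- q) :+ (q :- s) := p :- s) refl
      telescope′ : ∀ p q s → (q - s) + (p - q) ≡ p - s
      telescope′ = solve 3 (λ p q s → (q :- s) :+ (p :- q) := p :- s) refl

    F-close : ∀ a b → a ℕ.≤ b → ∣ F (suc a) - F (suc b) ∣ ≤ recip a
    F-close a b a≤b = subst (_≤ recip a) (dist-sym (F (suc b)) (F (suc a)))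
      (subst (λ z → ∣ F (suc z) - F (suc a) ∣ ≤ recip a) (ℕP.m∸n+n≡m a≤b) (∣∣≤ lower upper))
      where
      d : ℕ
      d = b ℕ.∸ a
      lower : - recip a ≤ F (suc (d ℕ.+ a)) - F (suc a)
      lower = ≤-trans (neg-antimono-≤ {0ℚ} (0≤recip a)) (F-lower a d)
      upper : F (suc (d ℕ.+ a)) - F (suc a) ≤ recip a
      upper = ≤-trans (F-upper a d)
        (subst (recip a - recip (d ℕ.+ a) ≤_) (+-identityʳ (recip a))
          (+-monoʳ-≤ (recip a) (neg-antimono-≤ {0ℚ} (0≤recip (d ℕ.+ a)))))

    lnSum-cauchy : IsCauchy F
    lnSum-cauchy = ordered F go
      where
      go : ∀ ε → 0ℚ < ε → ∃[ N ] ∀ m n → N ℕ.≤ m → m ℕ.≤ n → ∣ F m - F n ∣ ≤ ε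
      go ε 0<ε = suc (proj₁ arch) , bound
        where
        arch : ∃[ N ] ∀ n → N ℕ.≤ n → recip n ≤ ε
        arch = archimedean ε 0<ε
        bound : ∀ m n → suc (proj₁ arch) ℕ.≤ m → m ℕ.≤ n → ∣ F m - F n ∣ ≤ ε
        bound (suc a) (suc b) (s≤s N≤a) (s≤s a≤b) = ≤-trans (F-close a b a≤b) (proj₂ arch a N≤a)

open LnLemmas

ln : (N : ℕ) → .{{ℕ.NonZero N}} → ℝ
ln (suc j) = mkℝ (lnSum (suc j)) (lnSum-cauchy j)

infixr 9 _^ᴿ_

_^ᴿ_ : (n : ℕ) → .{{ℕ.NonZero n}} → ℝ → ℝ
n ^ᴿ x = exp (x *ᴿ ln n)

harmonic-ln : ℕ → ℝ
harmonic-ln k = fromℚ (harmonic (suc k)) -ᴿ ln (suc k)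

module γLemmas where

  harmonic-ln-symm : ∀ j k → seq (harmonic-ln k) j ≡ harmonic j - lnSum j (suc k)
  harmonic-ln-symm j k = trans (regroup (harmonic (suc k)) (harmonic (suc k ℕ.* j)) (harmonic j))
    (cong (λ z → harmonic j - (harmonic z - harmonic (suc k))) (ℕP.*-comm (suc k) j))
    where
    regroup : ∀ p q s → p - (q - s) ≡ s - (q - p)
    regroup = solve 3 (λ p q s → p :- (q :- s) := s :- (q :- p)) refl

  harmonic-ln-close : ∀ j a b → a ℕ.≤ b → ∣ seq (harmonic-ln a) (suc j) - seq (harmonic-ln b) (suc j) ∣ ≤ recip a
  harmonic-ln-close j a b a≤b = subst (_≤ recip a)
    (trans (dist-sym (G a) (G b))
      (cong ∣_∣ (trans (regroup (harmonic (suc j)) (G a) (G b))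
        (sym (cong₂ _-_ (harmonic-ln-symm (suc j) a) (harmonic-ln-symm (suc j) b))))))
    (F-close j a b a≤b)
    where
    G : ℕ → ℚ
    G k = lnSum (suc j) (suc k)
    regroup : ∀ h p q → q - p ≡ (h - p) - (h - q)
    regroup = solve 3 (λ h p q → q :- p := (h :- p) :- (h :- q)) refl

  harmonic-ln-cauchy : IsCauchyᴿ harmonic-ln
  harmonic-ln-cauchy ε 0<ε = proj₁ arch , λ m n p q η 0<η → 1 , bound m n p q η 0<η
    where
    arch : ∃[ N ] ∀ n → N ℕ.≤ n → recip n ≤ ε
    arch = archimedean ε 0<ε
    close : ∀ j m n → proj₁ arch ℕ.≤ m → proj₁ arch ℕ.≤ n →
      ∣ seq (harmonic-ln m) (suc j) - seq (harmonic-ln n) (suc j) ∣ ≤ ε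
    close j m n p q with ℕP.≤-total m n
    ... | inj₁ m≤n = ≤-trans (harmonic-ln-close j m n m≤n) (proj₂ arch m p)
    ... | inj₂ n≤m = subst (_≤ ε) (dist-sym (seq (harmonic-ln n) (suc j)) (seq (harmonic-ln m) (suc j)))
      (≤-trans (harmonic-ln-close j n m n≤m) (proj₂ arch n q))
    bound : ∀ m n → proj₁ arch ℕ.≤ m → proj₁ arch ℕ.≤ n → ∀ η → 0ℚ < η → ∀ i → 1 ℕ.≤ i →
      ∣ seq (harmonic-ln m) i - seq (harmonic-ln n) i ∣ ≤ ε + η
    bound m n p q η 0<η (suc j) _ = ≤-trans (close j m n p q)
      (subst (_≤ ε + η) (+-identityʳ ε) (+-monoʳ-≤ ε (<⇒≤ 0<η)))

open γLemmas

-- Euler's constant, as the limit of Hₙ - ln n along n = k + 1.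
γ : ℝ
γ = lim harmonic-ln harmonic-ln-cauchy

τ : ℕ → ℕ
τ n = length (filter (_∣? n) (applyUpTo suc n))

module τLemmas where

  nonempty : ∀ {x} {xs : List ℕ} → x ∈ xs → ℕ.NonZero (length xs)
  nonempty {xs = _ ∷ _} _ = _

open τLemmas

instance
  τ-nonZero : ∀ {n} → .{{ℕ.NonZero n}} → ℕ.NonZero (τ n)
  τ-nonZero {n@(suc _)} = nonempty (∈-filter⁺ (_∣? n) (∈-applyUpTo⁺ suc (s≤s z≤n)) (1∣ n))

τ-sum : ℕ → ℕ
τ-sum N = sum (map τ (applyUpTo suc N))

divisorError : (N : ℕ) → .{{ℕ.NonZero N}} → ℝ
divisorError N = fromℕ (τ-sum N) -ᴿ (fromℕ N *ᴿ ln N +ᴿ (2ᴿ *ᴿ γ -ᴿ 1ᴿ) *ᴿ fromℕ N)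

-- θ is the infimum of this set.
DivisorExponent : ℝ → Set
DivisorExponent l = 0ᴿ <ᴿ l × (∀ ε → 0ᴿ <ᴿ ε →
  ∃[ C ] ∃[ N₀ ] ∀ N → .{{_ : ℕ.NonZero N}} → N₀ ℕ.≤ N → ∣ divisorError N ∣ᴿ ≤ᴿ C *ᴿ N ^ᴿ (l +ᴿ ε))

IsInfimum : (ℝ → Set) → ℝ → Set
IsInfimum S θ = (∀ s → S s → θ ≤ᴿ s) × (∀ l → (∀ s → S s → l ≤ᴿ s) → l ≤ᴿ θ)

IsMaximum : (ℕ → Set) → (ℕ → ℕ) → ℕ → Set
IsMaximum P f M = (∃[ m ] P m × f m ≡ M) × (∀ m → P m → f m ℕ.≤ M)

InRange : (n : ℕ) → .{{ℕ.NonZero n}} → (μ : ℝ) → 0ᴿ <ᴿ μ → ℕ → Set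
InRange n μ 0<μ m = 1 ℕ.≤ m × fromℕ m ≤ᴿ n ^ᴿ reciprocal μ 0<μ

-- T_n(μ) = t. This is a relation rather than a function because ≤ᴿ, and hence the
-- range of m, is not decidable.
IsT : (n : ℕ) → .{{ℕ.NonZero n}} → (μ : ℝ) → 0ᴿ <ᴿ μ → ℚ → Set
IsT n μ 0<μ t = ∃[ M ] IsMaximum (InRange n μ 0<μ) (λ m → τ (n ℕ.+ m)) M × t ≡ + M / τ n

module TLemmas where

  harmonic-mono : ∀ d n → harmonic n ≤ harmonic (d ℕ.+ n)
  harmonic-mono zero    n = ≤-refl
  harmonic-mono (suc d) n = subst (_≤ harmonic (suc d ℕ.+ n)) (+-identityʳ (harmonic n))
    (+-mono-≤ (harmonic-mono d n) (0≤recip (d ℕ.+ n)))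

  0≤lnSum : ∀ j n → 0ℚ ≤ lnSum (suc j) n
  0≤lnSum j n = subst₂ _≤_ (+-inverseʳ (harmonic n))
    (cong (λ z → harmonic z - harmonic n) (ℕP.+-comm (j ℕ.* n) n))
    (+-monoˡ-≤ (- harmonic n) (harmonic-mono (j ℕ.* n) n))

  1≤expSum : ∀ q → 0ℚ ≤ q → ∀ n → 1ℚ ≤ expSum q n
  1≤expSum q 0≤q zero    = ≤-refl
  1≤expSum q 0≤q (suc n) = subst (_≤ expSum q (suc n)) (+-identityʳ 1ℚ)
    (+-mono-≤ (1≤expSum q 0≤q n) (0≤t q 0≤q (suc n)))

  1-inRange : ∀ n .{{_ : ℕ.NonZero n}} μ (0<μ : 0ᴿ <ᴿ μ) → InRange n μ 0<μ 1
  1-inRange (suc j) μ 0<μ = ℕP.≤-refl , λ ε 0<ε → 0 , λ i _ →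
    subst (_≤ expSum (q i) i + ε) (+-identityʳ 1ℚ)
      (+-mono-≤ (1≤expSum (q i) (0≤q i) i) (<⇒≤ 0<ε))
    where
    q : ℕ → ℚ
    q i = seq (reciprocal μ 0<μ) i * lnSum (suc j) i
    0≤q : ∀ i → 0ℚ ≤ q i
    0≤q i = 0≤* (<⇒≤ (0<1/ _ (tail-positive μ 0<μ i))) (0≤lnSum j i)

  r-upper : ∀ q → ∃[ B ] q ≤ r B
  r-upper q@(mkℚ n d _) = ℤ.∣ n ∣ , toℚᵘ-cancel-≤
    (ℚᵘP.≤-respʳ-≃ (ℚᵘP.≃-sym (toℚᵘ-fromℚᵘ (mkℚᵘ (+ ℤ.∣ n ∣) 0))) (*≤* (le n)))
    where
    le : ∀ n → n ℤ.* + 1 ℤ.≤ + ℤ.∣ n ∣ ℤ.* + suc d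
    le (+ n) = subst₂ ℤ._≤_ (ℤP.pos-* n 1) (ℤP.pos-* n (suc d)) (ℤ.+≤+ (ℕP.*-monoʳ-≤ n (s≤s z≤n)))
    le (ℤ.-[1+ n ]) = ℤ.-≤+

  r-strict : ∀ {m n} → m ℕ.< n → ¬ (r n ≤ r m)
  r-strict {m} {n} m<n rn≤rm = ℕP.<⇒≱ m<n (ℕP.*-cancelʳ-≤ n m 1 (ℤP.drop‿+≤+ (subst₂ ℤ._≤_ (sym (ℤP.pos-* n 1)) (sym (ℤP.pos-* m 1))
    (ℚᵘP.drop-*≤* (ℚᵘP.≤-respʳ-≃ (toℚᵘ-fromℚᵘ (mkℚᵘ (+ m) 0)) (ℚᵘP.≤-respˡ-≃ (toℚᵘ-fromℚᵘ (mkℚᵘ (+ n) 0)) (toℚᵘ-mono-≤ rn≤rm)))))))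

  ≤ᴿ-bounded : ∀ x → ∃[ B ] ∀ m → fromℕ m ≤ᴿ x → m ℕ.≤ B
  ≤ᴿ-bounded x = B , bound
    where
    b : ℚ
    b = proj₁ (bounded (seq x) (isCauchy x))
    B : ℕ
    B = proj₁ (r-upper (b + 1ℚ))
    bound : ∀ m → fromℕ m ≤ᴿ x → m ℕ.≤ B
    bound m m≤x with m≤x 1ℚ (positive⁻¹ 1ℚ)
    ... | N , h = ℕP.≮⇒≥ λ B<m → r-strict B<m (≤-trans (h N ℕP.≤-refl)
      (≤-trans (+-monoˡ-≤ 1ℚ (≤-trans (p≤∣p∣ (seq x N)) (proj₂ (proj₂ (bounded (seq x) (isCauchy x))) N)))
        (proj₂ (r-upper (b + 1ℚ)))))

  module _ (P : ℕ → Set) (f : ℕ → ℕ) where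

    private
      Best : ℕ → Set
      Best B = (∃[ m ] P m × (∀ m′ → m′ ℕ.≤ B → P m′ → f m′ ℕ.≤ f m)) ⊎ (∀ m → m ℕ.≤ B → ¬ P m)

      extend : ∀ B → Dec (P (suc B)) → Best B → Best (suc B)
      extend B (no ¬p) (inj₁ (m , pm , h)) = inj₁ (m , pm , λ m′ m′≤ pm′ → case≤ m′≤
        (λ m′≤B → h m′ m′≤B pm′) (λ eq → ⊥-elim (¬p (subst P eq pm′))))
        where
        case≤ : ∀ {m′} {C : Set} → m′ ℕ.≤ suc B → (m′ ℕ.≤ B → C) → (m′ ≡ suc B → C) → C
        case≤ le f g with ℕP.m≤n⇒m<n∨m≡n le
        ... | inj₁ (s≤s le′) = f le′
        ... | inj₂ eq = g eq
      extend B (no ¬p) (inj₂ none) = inj₂ none′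
        where
        none′ : ∀ m → m ℕ.≤ suc B → ¬ P m
        none′ m le pm with ℕP.m≤n⇒m<n∨m≡n le
        ... | inj₁ (s≤s le′) = none m le′ pm
        ... | inj₂ refl = ¬p pm
      extend B (yes p) (inj₂ none) = inj₁ (suc B , p , top)
        where
        top : ∀ m′ → m′ ℕ.≤ suc B → P m′ → f m′ ℕ.≤ f (suc B)
        top m′ le pm′ with ℕP.m≤n⇒m<n∨m≡n le
        ... | inj₁ (s≤s le′) = ⊥-elim (none m′ le′ pm′)
        ... | inj₂ refl = ℕP.≤-refl
      extend B (yes p) (inj₁ (m , pm , h)) with ℕP.≤-total (f m) (f (suc B))
      ... | inj₁ up = inj₁ (suc B , p , top)
        where
        top : ∀ m′ → m′ ℕ.≤ suc B → P m′ → f m′ ℕ.≤ f (suc B)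
        top m′ le pm′ with ℕP.m≤n⇒m<n∨m≡n le
        ... | inj₁ (s≤s le′) = ℕP.≤-trans (h m′ le′ pm′) up
        ... | inj₂ refl = ℕP.≤-refl
      ... | inj₂ down = inj₁ (m , pm , top)
        where
        top : ∀ m′ → m′ ℕ.≤ suc B → P m′ → f m′ ℕ.≤ f m
        top m′ le pm′ with ℕP.m≤n⇒m<n∨m≡n le
        ... | inj₁ (s≤s le′) = h m′ le′ pm′
        ... | inj₂ refl = down

      best : ∀ B → ¬ ¬ Best B
      best zero    k = ¬¬-excluded-middle λ where
        (yes p) → k (inj₁ (0 , p , λ { .0 z≤n _ → ℕP.≤-refl }))
        (no ¬p) → k (inj₂ λ { .0 z≤n → ¬p })
      best (suc B) k = best B λ b → ¬¬-excluded-middle λ d → k (extend B d b)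

    maximum-exists : ∀ B → (∀ m → P m → m ℕ.≤ B) → ∀ m → P m → ¬ ¬ (∃[ M ] IsMaximum P f M)
    maximum-exists B P≤B m₀ pm₀ k = best B λ where
      (inj₁ (m , pm , h)) → k (f m , (m , pm , refl) , λ m′ pm′ → h m′ (P≤B m′ pm′) pm′)
      (inj₂ none) → none m₀ (P≤B m₀ pm₀) pm₀

open TLemmas

-- Classically T_n(μ) is defined for every n ≥ 1 and μ > 0.
T-defined : ∀ n .{{_ : ℕ.NonZero n}} μ (0<μ : 0ᴿ <ᴿ μ) → ¬ ¬ (∃[ t ] IsT n μ 0<μ t)
T-defined n μ 0<μ k = maximum-exists (InRange n μ 0<μ) (λ m → τ (n ℕ.+ m))
  (proj₁ range-bounded) (λ m inRange → proj₂ range-bounded m (proj₂ inRange))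
  1 (1-inRange n μ 0<μ) λ where (M , isMax) → k (+ M / τ n , M , isMax , refl)
  where
  range-bounded : ∃[ B ] ∀ m → fromℕ m ≤ᴿ n ^ᴿ reciprocal μ 0<μ → m ℕ.≤ B
  range-bounded = ≤ᴿ-bounded (n ^ᴿ reciprocal μ 0<μ)

T-unique : ∀ n .{{_ : ℕ.NonZero n}} μ (0<μ : 0ᴿ <ᴿ μ) {t u} → IsT n μ 0<μ t → IsT n μ 0<μ u → t ≡ u
T-unique n μ 0<μ (M , ((m , pm , fm) , M-max) , refl) (M′ , ((m′ , pm′ , fm′) , M′-max) , refl) =
  cong (λ z → + z / τ n) (ℕP.≤-antisym (subst (ℕ._≤ M′) fm (M′-max m pm)) (subst (ℕ._≤ M) fm′ (M-max m′ pm′)))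

1≤⇒0< : ∀ μ → 1ᴿ ≤ᴿ μ → 0ᴿ <ᴿ μ
1≤⇒0< μ 1≤μ = ½ , 0<½ , proj₁ (1≤μ ½ 0<½) , λ n N≤n →
  subst₂ _≤_ refl (cancel (seq μ n)) (+-monoˡ-≤ (- ½) (proj₂ (1≤μ ½ 0<½) n N≤n))
  where
  cancel : ∀ x → (x + ½) - ½ ≡ x
  cancel = solve 1 (λ x → (x :+ con ½) :- con ½ := x) refl

_⟶∞ : (ℕ → ℕ) → Set
a ⟶∞ = ∀ B → ∃[ K ] ∀ k → K ℕ.≤ k → B ℕ.≤ a k

-- R k t says that the k-th term is t.
DivergesToInfinity : (ℕ → ℚ → Set) → Set
DivergesToInfinity R = ∀ B → ∃[ K ] ∀ k → K ℕ.≤ k → ∀ t → R k t → B ≤ t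

{-# OPTIONS --safe #-}

-- For any modulus d ≤ n^{1/μ} some m in the range makes n + m a multiple of d. Let u be a
-- natural number ≥ μ and choose a maximal with (4^{6u})^a ≤ n. Then d = 6^a is admissible,
-- because ln n ≥ 6ua and e^q ≥ q^a/a! ≥ 6^a for q ≥ 6a. Hence τ(n + m) ≥ τ(6^a) = (a + 1)²,
-- whereas n = p^j ≥ 2^j has only τ(n) = j + 1 ≤ 12u(a + 1) divisors, and a → ∞ as n → ∞.
module Submission where

open import Defs
open ℝ
open RationalLemmas
open CauchyLemmas using (bounded)
open ReciprocalLemmas using (tail-positive)
open ExpLemmas using (0≤recip; r*recip; 0≤t)
open BlockLemmas using (block-lower)
open TLemmas using (harmonic-mono; 1≤expSum; r-upper)

open import Data.Fin.Base using (Fin; toℕ; remQuot; combine)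
open import Data.Fin.Properties using (injective⇒≤; toℕ<n; toℕ-injective; combine-remQuot)
open import Data.Integer.Base as ℤ using (+_)
import Data.Integer.Properties as ℤP
open import Data.List.Base using (List; length; lookup; map; filter; applyUpTo; upTo; _∷_)
open import Data.List.Membership.Propositional using (_∈_)
open import Data.List.Membership.Propositional.Properties
  using (∈-filter⁺; ∈-filter⁻; ∈-applyUpTo⁺; ∈-upTo⁺; ∈-map⁺; ∈-lookup; ∈-tabulate⁻)
open import Data.List.Properties using (length-map; length-upTo; length-tabulate)
open import Data.List.Relation.Binary.Subset.Propositional using (_⊆_)
open import Data.List.Relation.Unary.All as All using ()
open import Data.List.Relation.Unary.AllPairs using (_∷_)
open import Data.List.Relation.Unary.Any using (index)
open import Data.List.Relation.Unary.Any.Properties using (lookup-index)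
open import Data.List.Relation.Unary.Unique.Propositional using (Unique)
open import Data.List.Relation.Unary.Unique.Propositional.Properties using (filter⁺; applyUpTo⁺₁; tabulate⁺)
open import Data.Nat.Base using (ℕ; zero; suc; NonZero; _^_; _≤_; _<_; z≤n; s≤s; _∸_; >-nonZero; >-nonZero⁻¹; nonTrivial⇒n>1)
  renaming (_+_ to _+ℕ_; _*_ to _*ℕ_)
open import Data.Nat.Coprimality using (Coprime; coprime-divisor)
open import Data.Nat.DivMod using (_%_; _/_; m≡m%n+[m/n]*n; m%n<n)
open import Data.Nat.Divisibility
open import Data.Nat.Primality using (Prime; prime⇒irreducible; prime⇒nonZero; prime⇒nonTrivial; prime?; euclidsLemma)
import Data.Nat.Properties as ℕP
import Data.Nat.Solver as ℕS
open import Data.Product.Base using (∃-syntax; _×_; _,_; proj₁; proj₂)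
open import Data.Rational as ℚ using (ℚ; 0ℚ; 1ℚ; ½; 1/_)
import Data.Rational.Properties as ℚP
open import Data.Rational.Solver using (module +-*-Solver)
open import Data.Rational.Unnormalised.Base as ℚᵘ using (mkℚᵘ; *≡*; *≤*)
open import Data.Sum.Base using (inj₁; inj₂)
open import Relation.Binary.Definitions using (tri<; tri≈; tri>)
open import Relation.Binary.PropositionalEquality using (_≡_; refl; sym; trans; cong; cong₂; subst; subst₂; module ≡-Reasoning)
open import Relation.Nullary using (yes; no; contradiction)
open import Relation.Nullary.Decidable using (from-yes)

-- Duplicate-free lists.

module _ {A : Set} where

  unique⇒lookup-injective : {xs : List A} → Unique xs → ∀ i j → lookup xs i ≡ lookup xs j → i ≡ j
  unique⇒lookup-injective (_ ∷ _)    Fin.zero    Fin.zero    _  = refl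
  unique⇒lookup-injective (x∉ ∷ _)   Fin.zero    (Fin.suc j) eq = contradiction eq (All.lookup x∉ (∈-lookup j))
  unique⇒lookup-injective (x∉ ∷ _)   (Fin.suc i) Fin.zero    eq = contradiction (sym eq) (All.lookup x∉ (∈-lookup i))
  unique⇒lookup-injective (_ ∷ uniq) (Fin.suc i) (Fin.suc j) eq = cong Fin.suc (unique⇒lookup-injective uniq i j eq)

  -- Each position in `xs` is sent to a position in `ys` holding the same entry. As `xs` has no
  -- repetitions, this map between finite sets is injective.
  unique-⊆⇒length≤ : {xs ys : List A} → Unique xs → xs ⊆ ys → length xs ≤ length ys
  unique-⊆⇒length≤ {xs} {ys} uniq xs⊆ys = injective⇒≤ {f = position} λ {i} {j} eq →
    unique⇒lookup-injective uniq i j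
      (trans (lookup-index (mem i)) (trans (cong (lookup ys) eq) (sym (lookup-index (mem j)))))
    where
    mem : ∀ i → lookup xs i ∈ ys
    mem i = xs⊆ys (∈-lookup i)
    position : Fin (length xs) → Fin (length ys)
    position i = index (mem i)

-- Counting divisors.

-- `τ n` is by definition the length of this list, so inclusions of duplicate-free lists turn into
-- bounds on `τ`.
divisors : ℕ → List ℕ
divisors n = filter (_∣? n) (applyUpTo suc n)

divisors-unique : ∀ n → Unique (divisors n)
divisors-unique n = filter⁺ (_∣? n)
  (applyUpTo⁺₁ suc n λ i<j _ eq → ℕP.<⇒≢ i<j (ℕP.suc-injective eq))

∈-divisors⁺ : ∀ {d n} → .{{NonZero n}} → d ∣ n → d ∈ divisors n
∈-divisors⁺ {zero}  {suc _} 0∣n = contradiction (0∣⇒≡0 0∣n) λ ()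
∈-divisors⁺ {suc _} {n} d∣n = ∈-filter⁺ (_∣? n) (∈-applyUpTo⁺ suc (∣⇒≤ d∣n)) d∣n

injective-divisors⇒≤τ : ∀ {k n} .{{_ : NonZero n}} (f : Fin k → ℕ) →
  (∀ {x y} → f x ≡ f y → x ≡ y) → (∀ x → f x ∣ n) → k ≤ τ n
injective-divisors⇒≤τ {k} {n} f f-injective f∣n = subst (_≤ τ n) (length-tabulate f)
  (unique-⊆⇒length≤ (tabulate⁺ f-injective) λ d∈ → is-divisor (∈-tabulate⁻ d∈))
  where
  is-divisor : ∀ {d} → (∃[ x ] d ≡ f x) → d ∈ divisors n
  is-divisor (x , refl) = ∈-divisors⁺ (f∣n x)

-- Divisors of prime powers.

prime∤⇒coprime : ∀ {p d} → Prime p → p ∤ d → Coprime d p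
prime∤⇒coprime {d = d} pp p∤d (c∣d , c∣p) with prime⇒irreducible pp c∣p
... | inj₁ c≡1 = c≡1
... | inj₂ c≡p = contradiction (subst (_∣ d) c≡p c∣d) p∤d

-- Induction on `j`. If `p` does not divide `d`, then `d` is coprime to `p` and already divides the
-- next lower power; otherwise one factor `p` is cancelled on both sides.
∣p^j⇒≡p^i : ∀ {p} → Prime p → ∀ j {d} → d ∣ p ^ j → ∃[ i ] i ≤ j × d ≡ p ^ i
∣p^j⇒≡p^i pp zero d∣1 = 0 , z≤n , ∣1⇒≡1 d∣1
∣p^j⇒≡p^i {p} pp (suc j) {d} d∣p^1+j with p ∣? d
... | no p∤d with ∣p^j⇒≡p^i pp j (coprime-divisor (prime∤⇒coprime pp p∤d) d∣p^1+j)
...   | i , i≤j , eq = i , ℕP.m≤n⇒m≤1+n i≤j , eq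
∣p^j⇒≡p^i {p} pp (suc j) d∣p^1+j | yes (divides e refl)
  with ∣p^j⇒≡p^i pp j (*-cancelˡ-∣ p {{prime⇒nonZero pp}} (subst (_∣ p ^ suc j) (ℕP.*-comm e p) d∣p^1+j))
... | i , i≤j , refl = suc i , s≤s i≤j , ℕP.*-comm (p ^ i) p

τ[p^j]≤1+j : ∀ {p} → Prime p → ∀ j → τ (p ^ j) ≤ suc j
τ[p^j]≤1+j {p} pp j = subst (τ (p ^ j) ≤_) (trans (length-map (p ^_) (upTo (suc j))) (length-upTo (suc j)))
  (unique-⊆⇒length≤ (divisors-unique (p ^ j)) λ d∈ → power (∣p^j⇒≡p^i pp j (proj₂ (∈-filter⁻ (_∣? (p ^ j)) {xs = applyUpTo suc (p ^ j)} d∈))))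
  where
  power : ∀ {d} → (∃[ i ] i ≤ j × d ≡ p ^ i) → d ∈ map (p ^_) (upTo (suc j))
  power (i , i≤j , refl) = ∈-map⁺ (p ^_) (∈-upTo⁺ (s≤s i≤j))

-- Divisors of multiples of a power of 6.

^-injectiveʳ : ∀ m → 1 < m → ∀ {k l} → m ^ k ≡ m ^ l → k ≡ l
^-injectiveʳ m 1<m {k} {l} eq with ℕP.<-cmp k l
... | tri< k<l _ _ = contradiction eq (ℕP.<⇒≢ (ℕP.^-monoʳ-< m 1<m k<l))
... | tri≈ _ k≡l _ = k≡l
... | tri> _ _ l<k = contradiction (sym eq) (ℕP.<⇒≢ (ℕP.^-monoʳ-< m 1<m l<k))

2∤3^k : ∀ k → 2 ∤ 3 ^ k
2∤3^k zero    2∣1 = contradiction (∣1⇒≡1 2∣1) λ ()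
2∤3^k (suc k) 2∣3*3^k with euclidsLemma 3 (3 ^ k) (from-yes (prime? 2)) 2∣3*3^k
-- Since 3 = 2 + 1, this would give 2 ∣ 1, which is the case of exponent 0.
... | inj₁ 2∣3   = contradiction (∣m+n∣m⇒∣n {2} {2} {1} 2∣3 ∣-refl) (2∤3^k 0)
... | inj₂ 2∣3^k = 2∤3^k k 2∣3^k

-- Common factors 2 are cancelled until one exponent of 2 is 0. If only one of them is, then 2
-- divides a power of 3, which is impossible; if both are, powers of 3 are compared.
2^i*3^k-injective : ∀ i i′ {k k′} → 2 ^ i *ℕ 3 ^ k ≡ 2 ^ i′ *ℕ 3 ^ k′ → i ≡ i′ × k ≡ k′
2^i*3^k-injective zero zero {k} {k′} eq = refl , ^-injectiveʳ 3 (s≤s (s≤s z≤n))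
  (trans (sym (ℕP.*-identityˡ (3 ^ k))) (trans eq (ℕP.*-identityˡ (3 ^ k′))))
2^i*3^k-injective zero (suc i′) {k} {k′} eq = contradiction
  (subst (2 ∣_) (sym (trans (sym (ℕP.*-identityˡ (3 ^ k))) eq)) (∣m⇒∣m*n (3 ^ k′) (m∣m*n (2 ^ i′)))) (2∤3^k k)
2^i*3^k-injective (suc i) zero {k} {k′} eq = contradiction
  (subst (2 ∣_) (trans eq (ℕP.*-identityˡ (3 ^ k′))) (∣m⇒∣m*n (3 ^ k) (m∣m*n (2 ^ i)))) (2∤3^k k′)
2^i*3^k-injective (suc i) (suc i′) {k} {k′} eq
  with 2^i*3^k-injective i i′ (ℕP.*-cancelˡ-≡ _ _ 2
         (trans (sym (ℕP.*-assoc 2 (2 ^ i) (3 ^ k))) (trans eq (ℕP.*-assoc 2 (2 ^ i′) (3 ^ k′)))))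
... | i≡i′ , k≡k′ = cong suc i≡i′ , k≡k′

^-monoʳ-∣ : ∀ m {k l} → k ≤ l → m ^ k ∣ m ^ l
^-monoʳ-∣ m {k} {l} k≤l = subst (λ z → m ^ k ∣ m ^ z) (ℕP.m+[n∸m]≡n k≤l)
  (subst (m ^ k ∣_) (sym (ℕP.^-distribˡ-+-* m k (l ∸ k))) (m∣m*n (m ^ (l ∸ k))))

6^a≡2^a*3^a : ∀ a → 6 ^ a ≡ 2 ^ a *ℕ 3 ^ a
6^a≡2^a*3^a zero    = refl
6^a≡2^a*3^a (suc a) = trans (cong (6 *ℕ_) (6^a≡2^a*3^a a)) (regroup (2 ^ a) (3 ^ a))
  where
  open ℕS.+-*-Solver
  regroup : ∀ x y → 6 *ℕ (x *ℕ y) ≡ (2 *ℕ x) *ℕ (3 *ℕ y)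
  regroup = solve 2 (λ x y → con 6 :* (x :* y) := (con 2 :* x) :* (con 3 :* y)) refl

-- The divisors are 2^i 3^k with i, k ≤ a, the pair (i, k) being coded by one index through
-- `remQuot`. Two distinct primes make the count quadratic in `a`, while `τ` of a prime power is
-- only linear in the exponent.
6^a∣n⇒[1+a]²≤τ : ∀ a {n} .{{_ : NonZero n}} → 6 ^ a ∣ n → suc a *ℕ suc a ≤ τ n
6^a∣n⇒[1+a]²≤τ a {n} 6^a∣n = injective-divisors⇒≤τ f f-injective λ x → ∣-trans
  (*-pres-∣ (^-monoʳ-∣ 2 (toℕ≤a (proj₁ (rq x)))) (^-monoʳ-∣ 3 (toℕ≤a (proj₂ (rq x)))))
  (subst (_∣ n) (6^a≡2^a*3^a a) 6^a∣n)
  where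
  rq : Fin (suc a *ℕ suc a) → Fin (suc a) × Fin (suc a)
  rq = remQuot (suc a)
  f : Fin (suc a *ℕ suc a) → ℕ
  f x = 2 ^ toℕ (proj₁ (rq x)) *ℕ 3 ^ toℕ (proj₂ (rq x))
  toℕ≤a : ∀ (i : Fin (suc a)) → toℕ i ≤ a
  toℕ≤a i = ℕP.≤-pred (toℕ<n i)
  f-injective : ∀ {x y} → f x ≡ f y → x ≡ y
  f-injective {x} {y} eq with 2^i*3^k-injective (toℕ (proj₁ (rq x))) (toℕ (proj₁ (rq y))) eq
  ... | eq₁ , eq₂ = trans (sym (combine-remQuot {suc a} (suc a) x))
    (trans (cong₂ combine (toℕ-injective eq₁) (toℕ-injective eq₂)) (combine-remQuot {suc a} (suc a) y))

-- Next multiples and integer logarithms.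

-- `m` is the distance from `n` to the first multiple of `d` strictly beyond it; if `d` divides `n`,
-- this is `d` rather than 0, so that 1 ≤ m.
multiple-in-interval : ∀ n d .{{_ : NonZero d}} → ∃[ m ] 1 ≤ m × m ≤ d × d ∣ n +ℕ m
multiple-in-interval n d = d ∸ n % d , ℕP.m<n⇒0<n∸m (m%n<n n d) , ℕP.m∸n≤m d (n % d) ,
  divides (suc (n / d)) (begin
    n +ℕ (d ∸ n % d)                            ≡⟨ cong (_+ℕ (d ∸ n % d)) (m≡m%n+[m/n]*n n d) ⟩
    n % d +ℕ n / d *ℕ d +ℕ (d ∸ n % d)          ≡⟨ cong (_+ℕ (d ∸ n % d)) (ℕP.+-comm (n % d) (n / d *ℕ d)) ⟩
    n / d *ℕ d +ℕ n % d +ℕ (d ∸ n % d)          ≡⟨ ℕP.+-assoc (n / d *ℕ d) (n % d) (d ∸ n % d) ⟩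
    n / d *ℕ d +ℕ (n % d +ℕ (d ∸ n % d))        ≡⟨ cong (n / d *ℕ d +ℕ_) (ℕP.m+[n∸m]≡n (ℕP.<⇒≤ (m%n<n n d))) ⟩
    n / d *ℕ d +ℕ d                             ≡⟨ ℕP.+-comm (n / d *ℕ d) d ⟩
    d +ℕ n / d *ℕ d                             ∎)
  where open ≡-Reasoning

-- Induction on `n`: the exponent stays the same unless the successor reaches d^(a+1) exactly, when
-- it rises by one.
log-floor : ∀ d → 1 < d → ∀ n .{{_ : NonZero n}} → ∃[ a ] d ^ a ≤ n × n < d ^ suc a
log-floor d 1<d (suc zero) = 0 , ℕP.≤-refl , subst (1 <_) (sym (ℕP.^-identityʳ d)) 1<d
log-floor d 1<d (suc n@(suc _)) with log-floor d 1<d n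
... | a , d^a≤n , n<d^1+a with ℕP.m≤n⇒m<n∨m≡n n<d^1+a
...   | inj₁ 1+n<d^1+a = a , ℕP.m≤n⇒m≤1+n d^a≤n , 1+n<d^1+a
...   | inj₂ 1+n≡d^1+a = suc a , ℕP.≤-reflexive (sym 1+n≡d^1+a) ,
  subst (_< d ^ suc (suc a)) (sym 1+n≡d^1+a) (ℕP.^-monoʳ-< d 1<d (ℕP.n<1+n (suc a)))

^-cancelʳ-< : ∀ m .{{_ : NonZero m}} {k l} → m ^ k < m ^ l → k < l
^-cancelʳ-< m m^k<m^l = ℕP.≰⇒> λ l≤k → ℕP.<⇒≱ m^k<m^l (ℕP.^-monoʳ-≤ m l≤k)

-- Natural numbers inside the rationals.

r-mono : ∀ {m n} → m ≤ n → r m ℚ.≤ r n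
r-mono {m} {n} m≤n = fromᵘ-≤ (mkℚᵘ (+ m) 0) (mkℚᵘ (+ n) 0) (*≤* (ℤP.*-monoʳ-≤-nonNeg (+ 1) (ℤ.+≤+ m≤n)))

0≤r : ∀ n → 0ℚ ℚ.≤ r n
0≤r n = r-mono {0} {n} z≤n

r-* : ∀ m n → r (m *ℕ n) ≡ r m ℚ.* r n
r-* m n = sym (trans (fromᵘ-* (mkℚᵘ (+ m) 0) (mkℚᵘ (+ n) 0))
  (ℚP.fromℚᵘ-cong {mkℚᵘ (+ m) 0 ℚᵘ.* mkℚᵘ (+ n) 0} {mkℚᵘ (+ (m *ℕ n)) 0} (*≡* (cong (ℤ._* + 1) (sym (ℤP.pos-* m n))))))

r-≤-/ : ∀ {b m} d .{{_ : NonZero d}} → b *ℕ d ≤ m → r b ℚ.≤ + m ℚ./ d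
r-≤-/ {b} {m} (suc d) b*d≤m = fromᵘ-≤ (mkℚᵘ (+ b) 0) (mkℚᵘ (+ m) d)
  (*≤* (subst₂ ℤ._≤_ (ℤP.pos-* b (suc d)) (ℤP.pos-* m 1)
    (ℤ.+≤+ (ℕP.≤-trans b*d≤m (ℕP.≤-reflexive (sym (ℕP.*-identityʳ m)))))))

-- Lower bounds for the logarithm.

-- Each of the n terms 1/(n+1), ..., 1/(2n) is at least 1/(2n).
harmonic-double : ∀ n .{{_ : NonZero n}} → harmonic n ℚ.+ ½ ℚ.≤ harmonic (n +ℕ n)
harmonic-double (suc c) = subst₂ ℚ._≤_ refl (cancel (harmonic (suc c)) (harmonic (suc c +ℕ suc c)))
  (ℚP.+-monoʳ-≤ (harmonic (suc c))
    (subst (ℚ._≤ harmonic (suc c +ℕ suc c) ℚ.- harmonic (suc c)) half-block (block-lower c c (suc c) ℕP.≤-refl)))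
  where
  cancel : ∀ h h′ → h ℚ.+ (h′ ℚ.- h) ≡ h′
  cancel = solve 2 (λ h h′ → h :+ (h′ :- h) := h′) refl
    where open +-*-Solver
  -- `recip i` is 1/(i+1), so this index stands for 1/(2(c+1)); the right-hand side is the form that
  -- `recip-scale c 1` expects.
  index≡ : c +ℕ suc c ≡ 1 +ℕ c *ℕ 2
  index≡ = solve 1 (λ c → c :+ (con 1 :+ c) := con 1 :+ c :* con 2) refl c
    where open ℕS.+-*-Solver
  half-block : r (suc c) ℚ.* recip (c +ℕ suc c) ≡ ½
  half-block = trans (cong (λ i → r (suc c) ℚ.* recip i) index≡) (recip-scale c 1)

-- Quadrupling is doubling twice and so gains ½ + ½ = 1. This is the source of the base 4: it gives
-- the bound ln 4 ≥ 1 without computing any logarithm.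
harmonic-4^ : ∀ e n .{{_ : NonZero n}} → harmonic n ℚ.+ r e ℚ.≤ harmonic (4 ^ e *ℕ n)
harmonic-4^ zero n = ℚP.≤-reflexive (trans (ℚP.+-identityʳ (harmonic n)) (cong harmonic (sym (ℕP.*-identityˡ n))))
harmonic-4^ (suc e) n = begin
  harmonic n ℚ.+ r (suc e)             ≡⟨ cong (harmonic n ℚ.+_) (r-suc e) ⟩
  harmonic n ℚ.+ (r e ℚ.+ 1ℚ)          ≡⟨ regroup (harmonic n) (r e) ⟩
  harmonic n ℚ.+ r e ℚ.+ ½ ℚ.+ ½       ≤⟨ ℚP.+-monoˡ-≤ ½ (ℚP.+-monoˡ-≤ ½ (harmonic-4^ e n)) ⟩
  harmonic m ℚ.+ ½ ℚ.+ ½               ≤⟨ ℚP.+-monoˡ-≤ ½ (harmonic-double m) ⟩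
  harmonic (m +ℕ m) ℚ.+ ½              ≤⟨ harmonic-double (m +ℕ m) ⟩
  harmonic ((m +ℕ m) +ℕ (m +ℕ m))      ≡⟨ cong harmonic (quadruple (4 ^ e) n) ⟩
  harmonic (4 ^ suc e *ℕ n)            ∎
  where
  open ℚP.≤-Reasoning
  m : ℕ
  m = 4 ^ e *ℕ n
  instance
    m≢0 : NonZero m
    m≢0 = ℕP.m*n≢0 (4 ^ e) n {{ℕP.m^n≢0 4 e}}
    m+m≢0 : NonZero (m +ℕ m)
    m+m≢0 = >-nonZero (ℕP.≤-trans (>-nonZero⁻¹ m) (ℕP.m≤m+n m m))
  regroup : ∀ h e → h ℚ.+ (e ℚ.+ 1ℚ) ≡ h ℚ.+ e ℚ.+ ½ ℚ.+ ½
  regroup = solve 2 (λ h e → h :+ (e :+ con 1ℚ) := h :+ e :+ con ½ :+ con ½) refl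
    where open +-*-Solver
  quadruple : ∀ x n → (x *ℕ n +ℕ x *ℕ n) +ℕ (x *ℕ n +ℕ x *ℕ n) ≡ 4 *ℕ x *ℕ n
  quadruple = solve 2 (λ x n → (x :* n :+ x :* n) :+ (x :* n :+ x :* n) := con 4 :* x :* n) refl
    where open ℕS.+-*-Solver

-- This is ln n ≥ e for every single Riemann sum and not just in the limit. Index 0 is excluded
-- because `lnSum n 0` is 0.
4^e≤n⇒e≤lnSum : ∀ {e n} → 4 ^ e ≤ n → ∀ i .{{_ : NonZero i}} → r e ℚ.≤ lnSum n i
4^e≤n⇒e≤lnSum {e} {n} 4^e≤n i = subst (ℚ._≤ lnSum n i) (cancel (harmonic i) (r e))
  (ℚP.+-monoˡ-≤ (ℚ.- harmonic i) (ℚP.≤-trans (harmonic-4^ e i)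
    (subst (λ z → harmonic (4 ^ e *ℕ i) ℚ.≤ harmonic z) (ℕP.m∸n+n≡m (ℕP.*-monoˡ-≤ i 4^e≤n))
      (harmonic-mono (n *ℕ i ∸ 4 ^ e *ℕ i) (4 ^ e *ℕ i)))))
  where
  cancel : ∀ h x → (h ℚ.+ x) ℚ.- h ≡ x
  cancel = solve 2 (λ h x → (h :+ x) :- h := x) refl
    where open +-*-Solver

-- Lower bounds for the exponential series.

-- q^i/i! is the product of q/1, ..., q/i, and each factor is at least `d` because q ≥ da and i ≤ a.
-- The case i = a is the one applied; the other exponents serve the induction.
^≤expTerm : ∀ d a {q} → r (d *ℕ a) ℚ.≤ q → ∀ {i} → i ≤ a → r (d ^ i) ℚ.≤ expTerm q i
^≤expTerm d a da≤q {zero} _ = ℚP.≤-refl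
^≤expTerm d a {q} da≤q {suc i} i<a = subst (ℚ._≤ expTerm q (suc i))
  (trans (sym (r-* (d ^ i) d)) (cong r (ℕP.*-comm (d ^ i) d)))
  (*-mono-≤ (0≤r d) (0≤t q (ℚP.≤-trans (0≤r (d *ℕ a)) da≤q) i)
    (^≤expTerm d a da≤q (ℕP.<⇒≤ i<a)) factor)
  where
  factor : r d ℚ.≤ q ℚ.* recip i
  factor = begin
    r d                                 ≡⟨ ℚP.*-identityʳ (r d) ⟨
    r d ℚ.* 1ℚ                          ≡⟨ cong (r d ℚ.*_) (r*recip i) ⟨
    r d ℚ.* (r (suc i) ℚ.* recip i)     ≡⟨ ℚP.*-assoc (r d) (r (suc i)) (recip i) ⟨
    r d ℚ.* r (suc i) ℚ.* recip i       ≡⟨ cong (ℚ._* recip i) (r-* d (suc i)) ⟨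
    r (d *ℕ suc i) ℚ.* recip i          ≤⟨ *-mono-≤ (0≤recip i) (ℚP.≤-trans (0≤r (d *ℕ a)) da≤q)
                                             (ℚP.≤-trans (r-mono (ℕP.*-monoʳ-≤ d i<a)) da≤q) ℚP.≤-refl ⟩
    q ℚ.* recip i                       ∎
    where open ℚP.≤-Reasoning

expTerm≤expSum : ∀ {q} → 0ℚ ℚ.≤ q → ∀ {k n} → k ≤ n → expTerm q k ℚ.≤ expSum q n
expTerm≤expSum 0≤q {n = zero} z≤n = ℚP.≤-refl
expTerm≤expSum {q} 0≤q {k} {suc n} k≤1+n with ℕP.m≤n⇒m<n∨m≡n k≤1+n
... | inj₁ (s≤s k≤n) = subst (ℚ._≤ expSum q (suc n)) (ℚP.+-identityʳ (expTerm q k))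
  (ℚP.+-mono-≤ (expTerm≤expSum 0≤q k≤n) (0≤t q 0≤q (suc n)))
... | inj₂ refl = subst (ℚ._≤ expSum q (suc n)) (ℚP.+-identityˡ (expTerm q (suc n)))
  (ℚP.+-monoˡ-≤ (expTerm q (suc n)) (ℚP.≤-trans (ℚP.<⇒≤ (ℚP.positive⁻¹ 1ℚ)) (1≤expSum q 0≤q n)))

-- Admissible shifts `m`.

-- The argument works term by term: the approximation of (ln n)/μ used in the exponential is at
-- least 6ua/u = 6a, and the term of degree `a` of the series then exceeds or equals 6^a.
≤6^a⇒inRange : ∀ {n} .{{_ : NonZero n}} μ (0<μ : 0ᴿ <ᴿ μ) u → (∀ i → seq μ i ℚ.≤ r u) →
  ∀ a → 4 ^ (u *ℕ (6 *ℕ a)) ≤ n → ∀ {m} → 1 ≤ m → m ≤ 6 ^ a → InRange n μ 0<μ m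
≤6^a⇒inRange {n@(suc _)} μ 0<μ@(δ , 0<δ , N , h) u μ≤u a 4^≤n {m} 1≤m m≤6^a =
  -- From index `suc a` on, the partial sum contains the term of degree `a`, and the index is
  -- nonzero as the bound on `lnSum` requires.
  1≤m , λ ε 0<ε → suc a , λ { i@(suc _) a<i → bound ε 0<ε i a<i }
  where
  bound : ∀ ε → 0ℚ ℚ.< ε → ∀ i .{{_ : NonZero i}} → a < i → r m ℚ.≤ seq (n ^ᴿ reciprocal μ 0<μ) i ℚ.+ ε
  bound ε 0<ε i a<i = begin
    r m                  ≤⟨ r-mono m≤6^a ⟩
    r (6 ^ a)            ≤⟨ ^≤expTerm 6 a 6a≤q ℕP.≤-refl ⟩
    expTerm q a          ≤⟨ expTerm≤expSum (ℚP.≤-trans (0≤r (6 *ℕ a)) 6a≤q) (ℕP.<⇒≤ a<i) ⟩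
    expSum q i           ≡⟨ ℚP.+-identityʳ (expSum q i) ⟨
    expSum q i ℚ.+ 0ℚ    ≤⟨ ℚP.+-monoʳ-≤ (expSum q i) (ℚP.<⇒≤ 0<ε) ⟩
    expSum q i ℚ.+ ε     ∎
    where
    open ℚP.≤-Reasoning
    x : ℚ
    -- `reciprocal` drops the first `N` terms of `μ`, hence the shifted index.
    x = seq μ (N +ℕ i)
    0<x : 0ℚ ℚ.< x
    0<x = tail-positive μ 0<μ i
    1/x q : ℚ
    1/x = (1/ x) {{ℚ.>-nonZero 0<x}}
    q = 1/x ℚ.* lnSum n i
    0≤1/x : 0ℚ ℚ.≤ 1/x
    0≤1/x = ℚP.<⇒≤ (0<1/ x 0<x)
    6a≤q : r (6 *ℕ a) ℚ.≤ q
    6a≤q = begin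
      r (6 *ℕ a)                       ≡⟨ ℚP.*-identityˡ (r (6 *ℕ a)) ⟨
      1ℚ ℚ.* r (6 *ℕ a)                ≡⟨ cong (ℚ._* r (6 *ℕ a)) (ℚP.*-inverseˡ x {{ℚ.>-nonZero 0<x}}) ⟨
      1/x ℚ.* x ℚ.* r (6 *ℕ a)         ≡⟨ ℚP.*-assoc 1/x x (r (6 *ℕ a)) ⟩
      1/x ℚ.* (x ℚ.* r (6 *ℕ a))       ≤⟨ scale (*-mono-≤ (0≤r (6 *ℕ a)) (0≤r u) (μ≤u (N +ℕ i)) ℚP.≤-refl) ⟩
      1/x ℚ.* (r u ℚ.* r (6 *ℕ a))     ≡⟨ cong (1/x ℚ.*_) (r-* u (6 *ℕ a)) ⟨
      1/x ℚ.* r (u *ℕ (6 *ℕ a))        ≤⟨ scale (4^e≤n⇒e≤lnSum {u *ℕ (6 *ℕ a)} 4^≤n i) ⟩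
      q                                ∎
      where
      scale : ∀ {y z} → y ℚ.≤ z → 1/x ℚ.* y ℚ.≤ 1/x ℚ.* z
      scale = ℚP.*-monoˡ-≤-nonNeg 1/x {{ℚ.nonNegative 0≤1/x}}

-- Growth of T along prime powers.

seq-bounded-by-ℕ : ∀ x → ∃[ u ] 1 ≤ u × (∀ i → seq x i ℚ.≤ r u)
seq-bounded-by-ℕ x with bounded (seq x) (isCauchy x)
... | b , _ , ∣x∣≤b with r-upper b
-- Taking the successor makes the bound positive, which gives `1<base` below.
...   | u , b≤u = suc u , s≤s z≤n , λ i →
  ℚP.≤-trans (p≤∣p∣ (seq x i)) (ℚP.≤-trans (∣x∣≤b i) (ℚP.≤-trans b≤u (r-mono (ℕP.n≤1+n u))))

module _ (μ : ℝ) (0<μ : 0ᴿ <ᴿ μ) (u : ℕ) (1≤u : 1 ≤ u) (μ≤u : ∀ i → seq μ i ℚ.≤ r u) where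

  private
    base : ℕ
    base = 4 ^ (u *ℕ 6)
    instance
      base≢0 : NonZero base
      base≢0 = ℕP.m^n≢0 4 (u *ℕ 6)
    1<base : 1 < base
    1<base = ℕP.^-monoʳ-< 4 (s≤s (s≤s z≤n)) (ℕP.≤-trans 1≤u (ℕP.m≤m*n u 6))

  -- Put c = 12u. Then τ(n) ≤ j + 1 ≤ c(a+1) and Bc < a + 1, so B τ(n) ≤ (a+1)² ≤ τ(n+m). The
  -- threshold base^(Bc) depends only on `B` and `u`, so it is uniform in `p` and `j`.
  prime-power-T-large : ∀ B n .{{_ : NonZero n}} p j → Prime p → n ≡ p ^ j →
    base ^ (B *ℕ (2 *ℕ (u *ℕ 6))) ≤ n → ∀ t → IsT n μ 0<μ t → r B ℚ.≤ t
  prime-power-T-large B n p j pp n≡p^j large t (M , (_ , M-max) , refl)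
    with log-floor base 1<base n
  ... | a , base^a≤n , n<base^1+a with multiple-in-interval n (6 ^ a) {{ℕP.m^n≢0 6 a}}
  ...   | m , 1≤m , m≤6^a , 6^a∣n+m = r-≤-/ {B} {M} (τ n) (begin
    B *ℕ τ n                               ≤⟨ ℕP.*-monoʳ-≤ B τn≤1+j ⟩
    B *ℕ suc j                             ≤⟨ ℕP.*-monoʳ-≤ B 1+j≤ ⟩
    B *ℕ (2 *ℕ (u *ℕ 6) *ℕ suc a)          ≡⟨ ℕP.*-assoc B (2 *ℕ (u *ℕ 6)) (suc a) ⟨
    B *ℕ (2 *ℕ (u *ℕ 6)) *ℕ suc a          ≤⟨ ℕP.*-monoˡ-≤ (suc a) (ℕP.<⇒≤ a-large) ⟩
    suc a *ℕ suc a                         ≤⟨ 6^a∣n⇒[1+a]²≤τ a {{n+m≢0}} 6^a∣n+m ⟩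
    τ (n +ℕ m)                             ≤⟨ M-max m inRange ⟩
    M                                      ∎)
    where
    open ℕP.≤-Reasoning
    n+m≢0 : NonZero (n +ℕ m)
    n+m≢0 = >-nonZero (ℕP.≤-trans 1≤m (ℕP.m≤n+m m n))
    τn≤1+j : τ n ≤ suc j
    τn≤1+j = subst (λ k → τ k ≤ suc j) (sym n≡p^j) (τ[p^j]≤1+j pp j)
    1+j≤ : suc j ≤ 2 *ℕ (u *ℕ 6) *ℕ suc a
    -- Both ends are written as powers of 2; the strict inequality of the exponents is already the
    -- bound on `suc j`.
    1+j≤ = ^-cancelʳ-< 2 (begin-strict
      2 ^ j                                ≤⟨ ℕP.^-monoˡ-≤ j (nonTrivial⇒n>1 p {{prime⇒nonTrivial pp}}) ⟩
      p ^ j                                ≡⟨ n≡p^j ⟨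
      n                                    <⟨ n<base^1+a ⟩
      base ^ suc a                         ≡⟨ cong (_^ suc a) (ℕP.^-*-assoc 2 2 (u *ℕ 6)) ⟩
      (2 ^ (2 *ℕ (u *ℕ 6))) ^ suc a        ≡⟨ ℕP.^-*-assoc 2 (2 *ℕ (u *ℕ 6)) (suc a) ⟩
      2 ^ (2 *ℕ (u *ℕ 6) *ℕ suc a)         ∎)
    a-large : B *ℕ (2 *ℕ (u *ℕ 6)) < suc a
    a-large = ^-cancelʳ-< base (ℕP.≤-<-trans large n<base^1+a)
    inRange : InRange n μ 0<μ m
    inRange = ≤6^a⇒inRange μ 0<μ u μ≤u a
      (subst (_≤ n) (trans (ℕP.^-*-assoc 4 (u *ℕ 6) a) (cong (4 ^_) (ℕP.*-assoc u 6 a))) base^a≤n) 1≤m m≤6^a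

theorem1p2 : (θ : ℝ) → IsInfimum DivisorExponent θ →
    (μ : ℝ) (1≤μ : 1ᴿ ≤ᴿ μ) → μ *ᴿ θ <ᴿ 1ᴿ →
    (n : ℕ → ℕ) (n-positive : ∀ k → NonZero (n k)) →
    (p j : ℕ → ℕ) → (∀ k → Prime (p k)) → (∀ k → 1 ≤ j k) → (∀ k → n k ≡ p k ^ j k) →
    n ⟶∞ →
    DivergesToInfinity (λ k t → IsT (n k) {{n-positive k}} μ (1≤⇒0< μ 1≤μ) t)
theorem1p2 θ _ μ 1≤μ _ n n-positive p j p-prime _ n≡p^j n⟶∞ B = proj₁ eventually , λ k K≤k t isT →
  -- The rational threshold `B` is replaced by a natural number `b` with B ≤ r b.
  ℚP.≤-trans (proj₂ (r-upper B))
    (prime-power-T-large μ 0<μ u 1≤u μ≤u b (n k) {{n-positive k}} (p k) (j k)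
      (p-prime k) (n≡p^j k) (proj₂ eventually k K≤k) t isT)
  where
  0<μ : 0ᴿ <ᴿ μ
  0<μ = 1≤⇒0< μ 1≤μ
  u b : ℕ
  u = proj₁ (seq-bounded-by-ℕ μ)
  b = proj₁ (r-upper B)
  1≤u : 1 ≤ u
  1≤u = proj₁ (proj₂ (seq-bounded-by-ℕ μ))
  μ≤u : ∀ i → seq μ i ℚ.≤ r u
  μ≤u = proj₂ (proj₂ (seq-bounded-by-ℕ μ))
  eventually : ∃[ K ] ∀ k → K ≤ k → (4 ^ (u *ℕ 6)) ^ (b *ℕ (2 *ℕ (u *ℕ 6))) ≤ n k
  eventually = n⟶∞ _
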